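{- Let $c_0$ be a proper $4$-colouring of the plane, let $\mu$ be a left-invariant finitely additive probability measure on $S_4\times E(2)$, and let $p_d$ be the associated monochromaticity probabilities (see context). Then for real $d\ge0$: (1) if $d\le\frac{\sqrt6-\sqrt2}{2}$, then $p_d\ge\frac1{50}$; (2) if $\frac{\sqrt6-\sqrt2}{2}<d\le\sqrt{\frac{14}{15}}-\frac1{\sqrt5}$, then $p_d\ge\frac{14}{775}$; (3) if $\sqrt{\frac{14}{15}}-\frac1{\sqrt5}<d\le\frac{\sqrt{15}}4-\frac{\sqrt3}4$, then $p_d\ge\frac1{100}$; (4) if $\frac{\sqrt{15}+\sqrt3}{4}\le d<\sqrt{\frac{14}{15}}+\frac1{\sqrt5}$, then $p_d\ge\frac1{100}$; (5) if $\sqrt{\frac{14}{15}}+\frac1{\sqrt5}\le d<\sqrt2$, then $p_d\ge\frac{14}{775}$; (6) if $\sqrt2\le d<2$, then $p_d\ge\frac1{50}$.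
   Context: Identify the plane with $\mathbb C$. A proper $4$-colouring of the plane is a map $c_0:\mathbb C\to\{1,2,3,4\}$ such that no two points at distance $1$ have the same colour. Let $S_4$ be the group of permutations of the colours and $E(2)$ the group of Euclidean isometries of the plane. The group $S_4\times E(2)$ is amenable, so there is a finitely additive probability measure $\mu$ defined on all subsets of $S_4\times E(2)$ which is left-invariant, i.e. $\mu(gE)=\mu(E)$ for all $g\in S_4\times E(2)$ and $E\subseteq S_4\times E(2)$. For $(\sigma,T)\in S_4\times E(2)$ consider the (random) colouring $c=\sigma\circ c_0\circ T^{ -1}$. For $d\ge 0$, $p_d$ denotes the probability that two points $A,B$ at distance $d$ get the same colour: $p_d=\mu(\{(\sigma,T): c(A)=c(B)\})$; by left-invariance this does not depend on the choice of $A,B$ with $|AB|=d$. The existence of $c_0$ is a standing assumption, and $c_0,\mu$ are arbitrary but fixed. -}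

module Defs where

open import Algebra.Bundles using (CommutativeRing; Group)
import Algebra.Construct.DirectProduct as DirectProduct
import Algebra.Construct.NaturalChoice.Max as Max
import Algebra.Properties.Ring as RingProperties
import Algebra.Properties.Monoid.Mult as Mult
open import Data.Fin.Base using (Fin)
open import Data.Nat.Base using (ℕ)
open import Data.Product.Base using (_×_; _,_; proj₁; proj₂; ∃)
open import Data.Product.Relation.Binary.Pointwise.NonDependent using (×-setoid)
open import Data.Sum.Base using (_⊎_; inj₁; inj₂)
open import Function.Base using (_∘_)
open import Function.Bundles using (Func; Inverse)
import Function.Construct.Composition as Composition
import Function.Construct.Identity as Identity
import Function.Construct.Symmetry as Symmetry
open import Level using (0ℓ)
open import Relation.Binary.Bundles using (Setoid; TotalOrder)
import Relation.Binary.Construct.NonStrictToStrict as NonStrictToStrict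
open import Relation.Binary.Core using (Rel)
open import Relation.Binary.Definitions using (_Respects_)
open import Relation.Binary.PropositionalEquality using (_≡_; _≢_)
import Relation.Binary.PropositionalEquality as ≡
open import Relation.Binary.Structures using (IsDecTotalOrder)
open import Relation.Nullary using (¬_)
open import Relation.Unary using (Pred; _∈_; _⊥_; _≐_; _∪_; U)

-- The library has no real numbers.  A model of them is a Dedekind-complete
-- ordered field; classically it is unique up to isomorphism.  As in classical
-- mathematics the order is decidable and every non-empty set which is bounded
-- above has a least upper bound.
record Reals : Set₁ where
  field
    commutativeRing : CommutativeRing 0ℓ 0ℓ

  open CommutativeRing commutativeRing public

  infix 4 _≤_
  infix 8 _⁻¹
  field
    _≤_             : Rel Carrier 0ℓ
    isDecTotalOrder : IsDecTotalOrder _≈_ _≤_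
    +-monoʳ-≤       : ∀ x {y z} → y ≤ z → x + y ≤ x + z
    *-nonNeg        : ∀ {x y} → 0# ≤ x → 0# ≤ y → 0# ≤ x * y
    0≉1             : ¬ 0# ≈ 1#
    -- 0# ⁻¹ is unspecified.
    _⁻¹             : Carrier → Carrier
    ⁻¹-inverseʳ     : ∀ x → ¬ x ≈ 0# → x * x ⁻¹ ≈ 1#

  IsUpperBound : Pred Carrier 0ℓ → Pred Carrier 0ℓ
  IsUpperBound P b = ∀ x → x ∈ P → x ≤ b

  IsLeastUpperBound : Pred Carrier 0ℓ → Pred Carrier 0ℓ
  IsLeastUpperBound P s = IsUpperBound P s × (∀ b → IsUpperBound P b → s ≤ b)

  field
    complete : (P : Pred Carrier 0ℓ) → ∃ P → ∃ (IsUpperBound P) →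
               ∃ (IsLeastUpperBound P)

  open IsDecTotalOrder isDecTotalOrder public
    using (_≟_; _≤?_; total; antisym; isTotalOrder; ≤-respˡ-≈; ≤-respʳ-≈)
    renaming (refl to ≤-refl; trans to ≤-trans; reflexive to ≤-reflexive)

  open NonStrictToStrict _≈_ _≤_ public using (_<_)

  totalOrder : TotalOrder 0ℓ 0ℓ 0ℓ
  totalOrder = record { isTotalOrder = isTotalOrder }

  open Max totalOrder using (_⊔_; x≤x⊔y; x≤y⊔x)
  open RingProperties ring using (-0#≈0#; -‿involutive; -‿distribʳ-*)

  fromℕ : ℕ → Carrier
  fromℕ n = n ×ℕ 1#
    where open Mult +-monoid renaming (_×_ to _×ℕ_)

  infixl 7 _/_
  _/_ : Carrier → Carrier → Carrier
  x / y = x * y ⁻¹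

  private
    0≤-x : ∀ {x} → x ≤ 0# → 0# ≤ - x
    0≤-x {x} x≤0 = ≤-respˡ-≈ (-‿inverseˡ x)
      (≤-respʳ-≈ (+-identityʳ (- x)) (+-monoʳ-≤ (- x) x≤0))

    0≤1 : 0# ≤ 1#
    0≤1 with total 0# 1#
    ... | inj₁ p = p
    ... | inj₂ q = ≤-respʳ-≈ eq (*-nonNeg (0≤-x q) (0≤-x q))
      where
      eq : - 1# * - 1# ≈ 1#
      eq = trans (sym (-‿distribʳ-* (- 1#) 1#))
                 (trans (-‿cong (*-identityʳ (- 1#))) (-‿involutive 1#))

    y≤y*y : ∀ {y} → 1# ≤ y → y ≤ y * y
    y≤y*y {y} 1≤y = ≤-respˡ-≈ eq₁ (≤-respʳ-≈ eq₂ (+-monoʳ-≤ y step))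
      where
      0≤y-1 : 0# ≤ - 1# + y
      0≤y-1 = ≤-respˡ-≈ (-‿inverseˡ 1#) (+-monoʳ-≤ (- 1#) 1≤y)
      step : 0# ≤ y * (- 1# + y)
      step = *-nonNeg (≤-trans 0≤1 1≤y) 0≤y-1
      eq₁ : y + 0# ≈ y
      eq₁ = +-identityʳ y
      eq₂ : y + y * (- 1# + y) ≈ y * y
      eq₂ = trans (+-congˡ (distribˡ y (- 1#) y))
           (trans (sym (+-assoc y (y * - 1#) (y * y)))
           (trans (+-congʳ (+-congˡ (trans (sym (-‿distribʳ-* y 1#))
                                           (-‿cong (*-identityʳ y)))))
           (trans (+-congʳ (-‿inverseʳ y)) (+-identityˡ (y * y)))))

  -- The disjunct y ≤ 0# makes this set non-empty also when x is negative;
  -- for x ≥ 0 it has the same supremum as { y ∣ y² ≤ x }.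
  SqrtSet : Carrier → Pred Carrier 0ℓ
  SqrtSet x y = y ≤ 0# ⊎ y * y ≤ x

  private
    SqrtSet-bounded : ∀ x → IsUpperBound (SqrtSet x) (1# ⊔ x)
    SqrtSet-bounded x y (inj₁ y≤0) =
      ≤-trans y≤0 (≤-trans 0≤1 (x≤x⊔y 1# x))
    SqrtSet-bounded x y (inj₂ y²≤x) with total y 1#
    ... | inj₁ y≤1 = ≤-trans y≤1 (x≤x⊔y 1# x)
    ... | inj₂ 1≤y = ≤-trans (y≤y*y 1≤y) (≤-trans y²≤x (x≤y⊔x 1# x))

    √-lub : ∀ x → ∃ (IsLeastUpperBound (SqrtSet x))
    √-lub x = complete (SqrtSet x) (0# , inj₁ ≤-refl) (1# ⊔ x , SqrtSet-bounded x)

  infix 8 √_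
  √_ : Carrier → Carrier
  √ x = proj₁ (√-lub x)

  √-isLeastUpperBound : ∀ x → IsLeastUpperBound (SqrtSet x) (√ x)
  √-isLeastUpperBound x = proj₂ (√-lub x)

  private
    √-mono : ∀ {x y} → x ≤ y → √ x ≤ √ y
    √-mono {x} {y} x≤y = proj₂ (√-isLeastUpperBound x) (√ y) λ where
      z (inj₁ z≤0)  → proj₁ (√-isLeastUpperBound y) z (inj₁ z≤0)
      z (inj₂ z²≤x) → proj₁ (√-isLeastUpperBound y) z (inj₂ (≤-trans z²≤x x≤y))

  √-cong : ∀ {x y} → x ≈ y → √ x ≈ √ y
  √-cong x≈y = antisym (√-mono (≤-reflexive x≈y)) (√-mono (≤-reflexive (sym x≈y)))

-- The group of permutations of a set; g ∙ f is "first f, then g".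
symmetricGroup : Setoid 0ℓ 0ℓ → Group 0ℓ 0ℓ
symmetricGroup S = record
  { Carrier = Inverse S S
  ; _≈_     = λ f g → ∀ x → to f x ≈ to g x
  ; _∙_     = λ g f → Composition.inverse f g
  ; ε       = Identity.inverse S
  ; _⁻¹     = Symmetry.inverse
  ; isGroup = record
    { isMonoid = record
      { isSemigroup = record
        { isMagma = record
          { isEquivalence = record
            { refl  = λ _ → refl
            ; sym   = λ p x → sym (p x)
            ; trans = λ p q x → trans (p x) (q x)
            }
          ; ∙-cong = λ {_} {g′} {f} p q x → trans (p (to f x)) (to-cong g′ (q x))
          }
        ; assoc = λ _ _ _ _ → refl
        }
      ; identity = (λ _ _ → refl) , (λ _ _ → refl)
      }
    ; inverse = strictlyInverseʳ , strictlyInverseˡ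
    ; ⁻¹-cong = λ {f} {g} p x →
        trans (from-cong f (sym (trans (p (from g x)) (strictlyInverseˡ g x))))
              (strictlyInverseʳ f (from g x))
    }
  }
  where
  open Setoid S
  open Inverse

S₄ : Group 0ℓ 0ℓ
S₄ = symmetricGroup (≡.setoid (Fin 4))

module Plane (ℝ : Reals) where

  open Reals ℝ

  ℂ : Setoid 0ℓ 0ℓ
  ℂ = ×-setoid setoid setoid

  open Setoid ℂ public using () renaming (Carrier to Point; _≈_ to _≈ᶜ_)

  dist : Point → Point → Carrier
  dist (x₁ , y₁) (x₂ , y₂) =
    √ ((x₁ - x₂) * (x₁ - x₂) + (y₁ - y₂) * (y₁ - y₂))

  dist-cong : ∀ {A A′ B B′} → A ≈ᶜ A′ → B ≈ᶜ B′ → dist A B ≈ dist A′ B′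
  dist-cong (p , q) (r , s) = √-cong (+-cong (*-cong pr pr) (*-cong qs qs))
    where
    pr = +-cong p (-‿cong r)
    qs = +-cong q (-‿cong s)

  record Isometry : Set where
    field
      bijection : Inverse ℂ ℂ
    open Inverse bijection public
    field
      isometric : ∀ A B → dist (to A) (to B) ≈ dist A B

  E₂ : Group 0ℓ 0ℓ
  E₂ = record
    { Carrier = Isometry
    ; _≈_     = λ S T → bijection S Sym.≈ bijection T
    ; _∙_     = λ S T → record
      { bijection = bijection S Sym.∙ bijection T
      ; isometric = λ A B → trans (isometric S (to T A) (to T B)) (isometric T A B)
      }
    ; ε       = record { bijection = Sym.ε ; isometric = λ _ _ → refl }
    ; _⁻¹     = λ T → record
      { bijection = bijection T Sym.⁻¹
      ; isometric = λ A B → trans (sym (isometric T (from T A) (from T B)))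
                                  (dist-cong (strictlyInverseˡ T A) (strictlyInverseˡ T B))
      }
    ; isGroup = record
      { isMonoid = record
        { isSemigroup = record
          { isMagma = record
            { isEquivalence = record
              { refl  = λ {T} → Sym.refl {bijection T}
              ; sym   = λ {S} {T} → Sym.sym {bijection S} {bijection T}
              ; trans = λ {S} {T} {V} →
                  Sym.trans {bijection S} {bijection T} {bijection V}
              }
            ; ∙-cong = λ {S} {S′} {T} {T′} →
                Sym.∙-cong {bijection S} {bijection S′} {bijection T} {bijection T′}
            }
          ; assoc = λ S T V → Sym.assoc (bijection S) (bijection T) (bijection V)
          }
        ; identity = Sym.identityˡ ∘ bijection , Sym.identityʳ ∘ bijection
        }
      ; inverse = Sym.inverseˡ ∘ bijection , Sym.inverseʳ ∘ bijection
      ; ⁻¹-cong = λ {S} {T} → Sym.⁻¹-cong {bijection S} {bijection T}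
      }
    }
    where
    module Sym = Group (symmetricGroup ℂ)
    open Isometry

  S₄×E₂ : Group 0ℓ 0ℓ
  S₄×E₂ = DirectProduct.group S₄ E₂

  module _ (G : Group 0ℓ 0ℓ) where

    private module G = Group G

    -- Subsets of the set underlying G, i.e. predicates that do not distinguish
    -- equal group elements.
    record Subset : Set₁ where
      field
        pred : Pred G.Carrier 0ℓ
        resp : pred Respects G._≈_

    open Subset

    whole : Subset
    whole = record { pred = λ g → g ∈ U ; resp = λ _ p → p }

    union : Subset → Subset → Subset
    union E F = record
      { pred = pred E ∪ pred F
      ; resp = λ where
          x≈y (inj₁ p) → inj₁ (resp E x≈y p)
          x≈y (inj₂ q) → inj₂ (resp F x≈y q)
      }

    leftTranslate : G.Carrier → Subset → Subset
    leftTranslate g E = record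
      { pred = λ h → ∃ λ e → e ∈ pred E × h G.≈ g G.∙ e
      ; resp = λ x≈y (e , e∈E , x≈ge) → e , e∈E , G.trans (G.sym x≈y) x≈ge
      }

    record LeftInvariantProbability : Set₁ where
      field
        μ             : Subset → Carrier
        μ-cong        : ∀ E F → pred E ≐ pred F → μ E ≈ μ F
        nonNegative   : ∀ E → 0# ≤ μ E
        normalised    : μ whole ≈ 1#
        additive      : ∀ E F → pred E ⊥ pred F → μ (union E F) ≈ μ E + μ F
        leftInvariant : ∀ g E → μ (leftTranslate g E) ≈ μ E

  Colouring : Set
  Colouring = Func ℂ (≡.setoid (Fin 4))

  Proper : Colouring → Set
  Proper c = ∀ A B → dist A B ≈ 1# → Func.to c A ≢ Func.to c B

  module _ (c₀ : Colouring) where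

    -- The colouring σ ∘ c₀ ∘ T⁻¹.
    recolour : Group.Carrier S₄×E₂ → Point → Fin 4
    recolour (σ , T) A = Inverse.to σ (Func.to c₀ (Isometry.from T A))

    Monochromatic : Point → Point → Subset S₄×E₂
    Monochromatic A B = record
      { pred = λ g → recolour g A ≡ recolour g B
      ; resp = λ {g} {h} g≈h p →
          ≡.trans (≡.sym (agree {g} {h} g≈h A)) (≡.trans p (agree {g} {h} g≈h B))
      }
      where
      agree : ∀ {g h} → Group._≈_ S₄×E₂ g h → ∀ C → recolour g C ≡ recolour h C
      agree {σ , S} {τ , T} (σ≈τ , S≈T) C =
        ≡.trans (σ≈τ (Func.to c₀ (Isometry.from S C)))
                (≡.cong (Inverse.to τ) (Func.cong c₀ (Group.⁻¹-cong E₂ {S} {T} S≈T C)))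

    -- p μ A B is the probability p_d for d = dist A B.
    p : LeftInvariantProbability S₄×E₂ → Point → Point → Carrier
    p μ A B = LeftInvariantProbability.μ μ (Monochromatic A B)

{-# OPTIONS --safe #-}
module Submission where

-- Let u, v be unit vectors with |u + v| = d and let ω = e^{iπ/3}.  Among 15 points of
-- ℤ[ω]u + ℤ[ω]v single out seven pairs: the sides of a triangle with side |u + ωv|, the sides
-- of a triangle with side |u + ω⁻¹v|, and a pair at distance 2.  If no edge of length 1 or d
-- is monochromatic, then at most three of these pairs are bichromatic, up to a correction
-- which compares the event that the second triangle is rainbow with the same event for a
-- congruent triangle and therefore has expectation zero; this is a finite check.  Each of the
-- seven pairs has distance at least 1/2 (for |u + ω⁻¹v| this is what the hypotheses on d give),
-- so it is a leg of an isosceles triangle with base 1 and is bichromatic with probability at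
-- least 1/2.  Charging 3 for each of the eight edges of length d yields 7/2 ≤ 3 + 24 p_d,
-- that is p_d ≥ 1/48.

open import Defs
open import Data.Product using (_×_; _,_; proj₁; proj₂; ∃)
open import Algebra.Bundles using (Group; RawRing)
import Algebra.Properties.Ring as RingProperties
import Algebra.Properties.Semiring.Mult as SemiringMult
import Algebra.Solver.Ring as RingSolver
open import Algebra.Solver.Ring.AlmostCommutativeRing using (_-Raw-AlmostCommutative⟶_; fromCommutativeRing)
open import Data.Bool.Base using (Bool; true; false; not; _∧_; _∨_; T)
open import Data.Bool.Properties using (T-∧; T-≡)
open import Data.Fin using (Fin; #_)
open import Data.Fin.Patterns using (0F; 1F; 2F; 3F)
import Data.Fin.Properties as Fin
open import Data.Integer.Base as ℤ using (ℤ; +_; -[1+_])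
import Data.Integer.Properties as ℤ
open import Data.List.Base as List using (List; []; _∷_; _++_; length)
open import Data.List.Membership.DecPropositional using () renaming (_∈?_ to member?)
open import Data.List.Membership.Propositional using (_∈_)
open import Data.List.Membership.Propositional.Properties using (∈-++⁻)
open import Data.List.Relation.Unary.All as All using (All; []; _∷_)
import Data.List.Relation.Unary.All.Properties as All
open import Data.List.Relation.Unary.Any using (here; there)
open import Data.Maybe.Base using (Maybe; just; nothing)
open import Data.Nat.Base as ℕ using (ℕ; zero; suc; z≤n; s≤s)
import Data.Nat.Properties as ℕ
open import Data.Product.Properties using (≡-dec)
import Data.Sign.Base as Sign
open import Data.Sum.Base using (_⊎_; inj₁; inj₂; [_,_]′)
open import Data.Unit.Base using (⊤; tt)
open import Data.Vec.Base as Vec using (Vec; []; _∷_; lookup)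
import Data.Vec.Properties as Vec
open import Data.Vec.Relation.Binary.Pointwise.Inductive using (Pointwise; []; _∷_)
open import Function.Base using (_∘_)
open import Function.Bundles using (Equivalence; Func; Inverse)
open import Level using (0ℓ)
open import Relation.Binary.Bundles using (Setoid)
open import Relation.Binary.Definitions using (DecidableEquality)
open import Relation.Binary.PropositionalEquality using (_≡_; _≢_)
import Relation.Binary.PropositionalEquality as ≡
import Relation.Binary.Reasoning.Setoid as SetoidReasoning
open import Relation.Nullary using (¬_; Dec; yes; no; contradiction; ⌊_⌋)
open import Relation.Nullary.Decidable using (True; toWitness)

-- The value 1/48 exceeds each of 1/50, 14/775 and 1/100, so a single bound serves all six ranges,
-- which matter only through |u + ω⁻¹v| ≥ 1/2. As |u + ω⁻¹v| = |√3 d - √(4 - d²)|/2, this condition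
-- says that d ≤ (√15 - √3)/4 or d ≥ (√15 + √3)/4. These are the outer thresholds of (3) and (4),
-- and the other four ranges lie inside them numerically. The correction is the difference of two
-- indicators: four bichromatic pairs are tolerated when the second triangle is rainbow and its
-- reflected copy is not, and only two in the opposite case. Each colouring has to satisfy the
-- corrected inequality, but the average does not see the correction. Since the measure is only
-- finitely additive, averaging is done without an integral: a pointwise inequality between numbers
-- of events is turned into one between sums of probabilities by splitting the group along finitely
-- many events.

-- A ring solver with integer coefficients.

module IntegerCoefficients (ℝ : Reals) where
  open Reals ℝ
  open RingProperties ring using (-0#≈0#; -‿involutive; -‿distribˡ-*; -‿distribʳ-*; -‿+-comm)
  open SemiringMult semiring using (×-homo-+; ×1-homo-*)
  open SetoidReasoning setoid

  -- This form makes `con (+ n)` in a solver equation evaluate to `fromℕ n` definitionally. Later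
  -- statements therefore write `fromℕ 1` instead of `1#`, from which it differs by a summand `0#`.
  fromℤ : ℤ → Carrier
  fromℤ (+ n)    = fromℕ n
  fromℤ -[1+ n ] = - fromℕ (suc n)

  fromℤ-⊖ : ∀ m n → fromℤ (m ℤ.⊖ n) ≈ fromℕ m - fromℕ n
  fromℤ-⊖ m zero = sym (trans (+-congˡ -0#≈0#) (+-identityʳ _))
  fromℤ-⊖ zero (suc n) = sym (+-identityˡ _)
  fromℤ-⊖ (suc m) (suc n) = begin
    fromℤ (suc m ℤ.⊖ suc n)               ≡⟨ ≡.cong fromℤ (ℤ.[1+m]⊖[1+n]≡m⊖n m n) ⟩
    fromℤ (m ℤ.⊖ n)                       ≈⟨ fromℤ-⊖ m n ⟩
    fromℕ m - fromℕ n                     ≈⟨ +-congʳ (+-identityˡ _) ⟨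
    (0# + fromℕ m) - fromℕ n              ≈⟨ +-congʳ (+-congʳ (-‿inverseʳ 1#)) ⟨
    ((1# - 1#) + fromℕ m) - fromℕ n       ≈⟨ +-congʳ (+-assoc _ _ _) ⟩
    (1# + (- 1# + fromℕ m)) - fromℕ n     ≈⟨ +-congʳ (+-congˡ (+-comm _ _)) ⟩
    (1# + (fromℕ m - 1#)) - fromℕ n       ≈⟨ +-congʳ (+-assoc _ _ _) ⟨
    ((1# + fromℕ m) - 1#) - fromℕ n       ≈⟨ +-assoc _ _ _ ⟩
    (1# + fromℕ m) + (- 1# - fromℕ n)     ≈⟨ +-congˡ (-‿+-comm _ _) ⟩
    fromℕ (suc m) - fromℕ (suc n)         ∎

  fromℤ-neg : ∀ i → fromℤ (ℤ.- i) ≈ - fromℤ i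
  fromℤ-neg (+ zero)  = sym -0#≈0#
  fromℤ-neg (+ suc n) = refl
  fromℤ-neg -[1+ n ]  = sym (-‿involutive _)

  fromℤ-+ : ∀ i j → fromℤ (i ℤ.+ j) ≈ fromℤ i + fromℤ j
  fromℤ-+ (+ m)    (+ n)    = ×-homo-+ 1# m n
  fromℤ-+ (+ m)    -[1+ n ] = fromℤ-⊖ m (suc n)
  fromℤ-+ -[1+ m ] (+ n)    = trans (fromℤ-⊖ n (suc m)) (+-comm _ _)
  fromℤ-+ -[1+ m ] -[1+ n ] = trans
    (-‿cong (trans (reflexive (≡.cong (λ k → fromℕ (suc k)) (≡.sym (ℕ.+-suc m n))))
                   (×-homo-+ 1# (suc m) (suc n))))
    (sym (-‿+-comm _ _))

  fromℤ-* : ∀ i j → fromℤ (i ℤ.* j) ≈ fromℤ i * fromℤ j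
  fromℤ-* (+ m) (+ n) = trans (reflexive (≡.cong fromℤ (ℤ.+◃n≡+n (m ℕ.* n)))) (×1-homo-* m n)
  fromℤ-* (+ m) -[1+ n ] = begin
    fromℤ (Sign.- ℤ.◃ m ℕ.* suc n)  ≡⟨ ≡.cong fromℤ (ℤ.-◃n≡-n (m ℕ.* suc n)) ⟩
    fromℤ (ℤ.- + (m ℕ.* suc n))     ≈⟨ fromℤ-neg (+ (m ℕ.* suc n)) ⟩
    - fromℕ (m ℕ.* suc n)           ≈⟨ -‿cong (×1-homo-* m (suc n)) ⟩
    - (fromℕ m * fromℕ (suc n))     ≈⟨ -‿distribʳ-* _ _ ⟩
    fromℕ m * - fromℕ (suc n)       ∎
  fromℤ-* -[1+ m ] (+ n) = begin
    fromℤ (Sign.- ℤ.◃ suc m ℕ.* n)  ≡⟨ ≡.cong fromℤ (ℤ.-◃n≡-n (suc m ℕ.* n)) ⟩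
    fromℤ (ℤ.- + (suc m ℕ.* n))     ≈⟨ fromℤ-neg (+ (suc m ℕ.* n)) ⟩
    - fromℕ (suc m ℕ.* n)           ≈⟨ -‿cong (×1-homo-* (suc m) n) ⟩
    - (fromℕ (suc m) * fromℕ n)     ≈⟨ -‿distribˡ-* _ _ ⟩
    - fromℕ (suc m) * fromℕ n       ∎
  fromℤ-* -[1+ m ] -[1+ n ] = begin
    fromℕ (suc m ℕ.* suc n)                ≈⟨ ×1-homo-* (suc m) (suc n) ⟩
    fromℕ (suc m) * fromℕ (suc n)          ≈⟨ -‿involutive _ ⟨
    - - (fromℕ (suc m) * fromℕ (suc n))    ≈⟨ -‿cong (-‿distribˡ-* _ _) ⟩
    - (- fromℕ (suc m) * fromℕ (suc n))    ≈⟨ -‿distribʳ-* _ _ ⟩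
    - fromℕ (suc m) * - fromℕ (suc n)      ∎

  private
    ℤ-rawRing : RawRing _ _
    ℤ-rawRing = record
      { Carrier = ℤ ; _≈_ = _≡_ ; _+_ = ℤ._+_ ; _*_ = ℤ._*_ ; -_ = ℤ.-_ ; 0# = ℤ.0ℤ ; 1# = ℤ.1ℤ }

    ℤ⟶ℝ : ℤ-rawRing -Raw-AlmostCommutative⟶ fromCommutativeRing commutativeRing
    ℤ⟶ℝ = record
      { ⟦_⟧ = fromℤ ; +-homo = fromℤ-+ ; *-homo = fromℤ-* ; -‿homo = fromℤ-neg
      ; 0-homo = refl ; 1-homo = +-identityʳ 1# }

    _coeff≟_ : ∀ i j → Maybe (fromℤ i ≈ fromℤ j)
    i coeff≟ j with i ℤ.≟ j
    ... | yes i≡j = just (reflexive (≡.cong fromℤ i≡j))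
    ... | no _    = nothing

  module Solver = RingSolver ℤ-rawRing (fromCommutativeRing commutativeRing) ℤ⟶ℝ _coeff≟_

-- Inequalities in an ordered field, and square roots.

module OrderedField (ℝ : Reals) where
  open Reals ℝ
  open IntegerCoefficients ℝ public
  open Solver using (solve; _:=_; _:+_; _:*_; _:-_; :-_; con)

  infixr 2 _⟨≤⟩_
  _⟨≤⟩_ : ∀ {x y z} → x ≤ y → y ≤ z → x ≤ z
  _⟨≤⟩_ = ≤-trans

  ≈⇒≤ : ∀ {x y} → x ≈ y → x ≤ y
  ≈⇒≤ = ≤-reflexive

  +-mono-≤ : ∀ {x y z w} → x ≤ y → z ≤ w → x + z ≤ y + w
  +-mono-≤ {x} {y} {z} {w} x≤y z≤w =
    +-monoʳ-≤ x z≤w ⟨≤⟩ ≈⇒≤ (+-comm x w) ⟨≤⟩ +-monoʳ-≤ w x≤y ⟨≤⟩ ≈⇒≤ (+-comm w y)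

  +-cancelʳ-≤ : ∀ z {x y} → x + z ≤ y + z → x ≤ y
  +-cancelʳ-≤ z {x} {y} p =
    ≈⇒≤ (cancel x) ⟨≤⟩ +-mono-≤ p ≤-refl ⟨≤⟩ ≈⇒≤ (sym (cancel y))
    where
    cancel : ∀ x → x ≈ (x + z) - z
    cancel x = solve 2 (λ x z → x := (x :+ z) :- z) refl x z

  x≤y⇒0≤y-x : ∀ {x y} → x ≤ y → 0# ≤ y - x
  x≤y⇒0≤y-x {x} x≤y = ≈⇒≤ (sym (-‿inverseʳ x)) ⟨≤⟩ +-mono-≤ x≤y ≤-refl

  0≤y-x⇒x≤y : ∀ {x y} → 0# ≤ y - x → x ≤ y
  0≤y-x⇒x≤y {x} {y} p = +-cancelʳ-≤ (- x) (≈⇒≤ (-‿inverseʳ x) ⟨≤⟩ p)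

  +-nonNeg : ∀ {x y} → 0# ≤ x → 0# ≤ y → 0# ≤ x + y
  +-nonNeg 0≤x 0≤y = ≈⇒≤ (sym (+-identityʳ 0#)) ⟨≤⟩ +-mono-≤ 0≤x 0≤y

  *-monoʳ-≤ : ∀ {x y z} → 0# ≤ x → y ≤ z → x * y ≤ x * z
  *-monoʳ-≤ {x} {y} {z} 0≤x y≤z = 0≤y-x⇒x≤y
    (*-nonNeg 0≤x (x≤y⇒0≤y-x y≤z) ⟨≤⟩
     ≈⇒≤ (solve 3 (λ x y z → x :* (z :- y) := x :* z :- x :* y) refl x y z))

  *-mono-≤ : ∀ {x y z w} → 0# ≤ x → 0# ≤ w → x ≤ y → z ≤ w → x * z ≤ y * w
  *-mono-≤ {x} {y} {z} {w} 0≤x 0≤w x≤y z≤w =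
    *-monoʳ-≤ 0≤x z≤w ⟨≤⟩ ≈⇒≤ (*-comm x w) ⟨≤⟩ *-monoʳ-≤ 0≤w x≤y ⟨≤⟩ ≈⇒≤ (*-comm w y)

  0≤x*x : ∀ x → 0# ≤ x * x
  0≤x*x x with total 0# x
  ... | inj₁ 0≤x = *-nonNeg 0≤x 0≤x
  ... | inj₂ x≤0 = *-nonNeg 0≤-x 0≤-x ⟨≤⟩ ≈⇒≤ (solve 1 (λ x → :- x :* :- x := x :* x) refl x)
    where
    0≤-x : 0# ≤ - x
    0≤-x = x≤y⇒0≤y-x x≤0 ⟨≤⟩ ≈⇒≤ (+-identityˡ (- x))

  fromℕ-nonNeg : ∀ n → 0# ≤ fromℕ n
  fromℕ-nonNeg zero    = ≤-refl
  fromℕ-nonNeg (suc n) = +-nonNeg (0≤x*x 1# ⟨≤⟩ ≈⇒≤ (*-identityˡ 1#)) (fromℕ-nonNeg n)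

  fromℕ-1 : fromℕ 1 ≈ 1#
  fromℕ-1 = +-identityʳ 1#

  fromℕ-mono-≤ : ∀ {m n} → m ℕ.≤ n → fromℕ m ≤ fromℕ n
  fromℕ-mono-≤ {n = n} ℕ.z≤n = fromℕ-nonNeg n
  fromℕ-mono-≤ (ℕ.s≤s m≤n)   = +-monoʳ-≤ 1# (fromℕ-mono-≤ m≤n)

  fromℕ-suc≉0 : ∀ n → ¬ fromℕ (suc n) ≈ 0#
  fromℕ-suc≉0 n eq = 0≉1 (antisym
    (fromℕ-nonNeg 1 ⟨≤⟩ ≈⇒≤ fromℕ-1)
    (≈⇒≤ (sym fromℕ-1) ⟨≤⟩ fromℕ-mono-≤ {1} {suc n} (ℕ.s≤s ℕ.z≤n) ⟨≤⟩ ≈⇒≤ eq))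

  ⁻¹-nonNeg : ∀ {x} → ¬ x ≈ 0# → 0# ≤ x → 0# ≤ x ⁻¹
  ⁻¹-nonNeg {x} x≉0 0≤x = *-nonNeg 0≤x (0≤x*x (x ⁻¹)) ⟨≤⟩ ≈⇒≤
    (trans (sym (*-assoc x _ _)) (trans (*-congʳ (⁻¹-inverseʳ x x≉0)) (*-identityˡ _)))

  ⁻¹-cancelˡ : ∀ {x} → ¬ x ≈ 0# → ∀ y → x ⁻¹ * (x * y) ≈ y
  ⁻¹-cancelˡ {x} x≉0 y = trans (sym (*-assoc _ x y))
    (trans (*-congʳ (trans (*-comm _ x) (⁻¹-inverseʳ x x≉0))) (*-identityˡ y))

  *-cancelˡ-≤ : ∀ {x y z} → ¬ x ≈ 0# → 0# ≤ x → x * y ≤ x * z → y ≤ z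
  *-cancelˡ-≤ {x} {y} {z} x≉0 0≤x p = ≈⇒≤ (sym (⁻¹-cancelˡ x≉0 y)) ⟨≤⟩
    *-monoʳ-≤ (⁻¹-nonNeg x≉0 0≤x) p ⟨≤⟩ ≈⇒≤ (⁻¹-cancelˡ x≉0 z)

  *-cancelˡ-≈ : ∀ {x y z} → ¬ x ≈ 0# → x * y ≈ x * z → y ≈ z
  *-cancelˡ-≈ {x} {y} {z} x≉0 p =
    trans (sym (⁻¹-cancelˡ x≉0 y)) (trans (*-congˡ p) (⁻¹-cancelˡ x≉0 z))

  /-inverse : ∀ {x y} → ¬ y ≈ 0# → y * (x / y) ≈ x
  /-inverse {x} {y} y≉0 = trans (solve 3 (λ x y i → y :* (x :* i) := x :* (y :* i)) refl x y (y ⁻¹))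
    (trans (*-congˡ (⁻¹-inverseʳ y y≉0)) (*-identityʳ x))

  square≈0 : ∀ {x} → x * x ≤ 0# → x ≈ 0#
  square≈0 {x} x²≤0 with x ≟ 0#
  ... | yes x≈0 = x≈0
  ... | no x≉0  = *-cancelˡ-≈ x≉0 (trans (antisym x²≤0 (0≤x*x x)) (sym (zeroʳ x)))

  -- If y ≤ x, then (x - y)² = x² - y² - 2y(x - y) ≤ 0, which forces x = y.
  square-cancel-≤ : ∀ {x y} → 0# ≤ y → x * x ≤ y * y → x ≤ y
  square-cancel-≤ {x} {y} 0≤y x²≤y² with total x y
  ... | inj₁ x≤y = x≤y
  ... | inj₂ y≤x = +-cancelʳ-≤ (- y) (≈⇒≤ (trans x-y≈0 (sym (-‿inverseʳ y))))
    where
    z = y * (x - y)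
    0≤z : 0# ≤ z
    0≤z = *-nonNeg 0≤y (x≤y⇒0≤y-x y≤x)
    x-y≈0 : x - y ≈ 0#
    x-y≈0 = square≈0 (+-cancelʳ-≤ (y * y + z + z)
      (≈⇒≤ (solve 2 (λ x y → (x :- y) :* (x :- y) :+ (y :* y :+ y :* (x :- y) :+ y :* (x :- y))
                       := x :* x :+ con (+ 0)) refl x y) ⟨≤⟩
       +-mono-≤ x²≤y² (+-nonNeg 0≤z 0≤z) ⟨≤⟩
       ≈⇒≤ (solve 2 (λ y z → y :* y :+ (z :+ z) := con (+ 0) :+ (y :* y :+ z :+ z)) refl y z)))

  square-cancel-≈ : ∀ {x y} → 0# ≤ x → 0# ≤ y → x * x ≈ y * y → x ≈ y
  square-cancel-≈ 0≤x 0≤y p =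
    antisym (square-cancel-≤ 0≤y (≈⇒≤ p)) (square-cancel-≤ 0≤x (≈⇒≤ (sym p)))

  √-nonNeg : ∀ x → 0# ≤ √ x
  √-nonNeg x = proj₁ (√-isLeastUpperBound x) 0# (inj₁ ≤-refl)

  private
    +-positive : ∀ {y z} → 0# ≤ y → 0# ≤ z → ¬ z ≈ 0# → ¬ y + z ≈ 0#
    +-positive {y} {z} 0≤y 0≤z z≉0 eq = z≉0 (antisym
      (≈⇒≤ (sym (+-identityˡ z)) ⟨≤⟩ +-mono-≤ 0≤y ≤-refl ⟨≤⟩ ≈⇒≤ eq) 0≤z)

    module _ {x} (0≤x : 0# ≤ x) where
      -- 2ax/(a²+x) has square at most x by AM-GM.
      lower : ∀ a → 0# ≤ a → ¬ a * a + x ≈ 0# → fromℕ 2 * (a * x) ≤ (a * a + x) * √ x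
      lower a 0≤a D≉0 =
        ≈⇒≤ (sym (/-inverse D≉0)) ⟨≤⟩
        *-monoʳ-≤ 0≤D (proj₁ (√-isLeastUpperBound x) t (inj₂ t²≤x))
        where
        D = a * a + x
        0≤D : 0# ≤ D
        0≤D = +-nonNeg (0≤x*x a) 0≤x
        t = fromℕ 2 * (a * x) / D
        DD≉0 : ¬ D * D ≈ 0#
        DD≉0 eq = D≉0 (square≈0 (≈⇒≤ eq))
        t²≤x : t * t ≤ x
        t²≤x = *-cancelˡ-≤ DD≉0 (0≤x*x D)
          (≈⇒≤ (trans (solve 2 (λ D t → D :* D :* (t :* t) := D :* t :* (D :* t)) refl D t)
                      (*-cong (/-inverse D≉0) (/-inverse D≉0))) ⟨≤⟩
           0≤y-x⇒x≤y (*-nonNeg 0≤x (0≤x*x (a * a - x)) ⟨≤⟩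
             ≈⇒≤ (solve 2 (λ a x → x :* ((a :* a :- x) :* (a :* a :- x)) :=
                    (a :* a :+ x) :* (a :* a :+ x) :* x :- con (+ 2) :* (a :* x) :* (con (+ 2) :* (a :* x)))
                    refl a x)))

  -- Let s be the supremum. If s ≠ 0, the upper bound (s² + x)/2s gives 2s² ≤ s² + x, and `lower` at
  -- a = s gives 2sx ≤ (s² + x)s, that is x ≤ s². If s = 0, `lower` at a = 1 gives 2x ≤ 0. No
  -- approximation argument is involved.
  √-square : ∀ {x} → 0# ≤ x → √ x * √ x ≈ x
  √-square {x} 0≤x with √ x ≟ 0#
  ... | yes s≈0 = trans s²≈0 (sym x≈0)
    where
    s²≈0 = trans (*-congˡ s≈0) (zeroʳ _)
    D = fromℕ 1 * fromℕ 1 + x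
    x≈0 : x ≈ 0#
    x≈0 with x ≟ 0#
    ... | yes x≈0 = x≈0
    ... | no x≉0 = antisym (*-cancelˡ-≤ (fromℕ-suc≉0 1) (fromℕ-nonNeg 2)
      (≈⇒≤ (solve 1 (λ x → con (+ 2) :* x := con (+ 2) :* (con (+ 1) :* x)) refl x) ⟨≤⟩
       lower 0≤x (fromℕ 1) (fromℕ-nonNeg 1) (+-positive (0≤x*x _) 0≤x x≉0) ⟨≤⟩
       ≈⇒≤ (trans (*-congˡ s≈0) (trans (zeroʳ D) (sym (zeroʳ (fromℕ 2))))))) 0≤x
  ... | no s≉0 = antisym
    (+-cancelʳ-≤ (√ x * √ x)
      (≈⇒≤ (solve 1 (λ s → s :* s :+ s :* s := con (+ 2) :* s :* s) refl (√ x)) ⟨≤⟩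
       upper ⟨≤⟩ ≈⇒≤ (+-comm _ x)))
    (*-cancelˡ-≤ s≉0 (√-nonNeg x) (+-cancelʳ-≤ (√ x * x)
      (≈⇒≤ (solve 2 (λ s x → s :* x :+ s :* x := con (+ 2) :* (s :* x)) refl (√ x) x) ⟨≤⟩
       lower 0≤x (√ x) (√-nonNeg x) D≉0 ⟨≤⟩
       ≈⇒≤ (solve 2 (λ s x → (s :* s :+ x) :* s := s :* (s :* s) :+ s :* x) refl (√ x) x))))
    where
    D≉0 : ¬ √ x * √ x + x ≈ 0#
    D≉0 eq = +-positive 0≤x (0≤x*x (√ x)) (λ e → s≉0 (square≈0 (≈⇒≤ e))) (trans (+-comm x _) eq)
    2s = fromℕ 2 * √ x
    0≤2s : 0# ≤ 2s
    0≤2s = *-nonNeg (fromℕ-nonNeg 2) (√-nonNeg x)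
    2s≉0 : ¬ 2s ≈ 0#
    2s≉0 eq = s≉0 (*-cancelˡ-≈ (fromℕ-suc≉0 1) (trans eq (sym (zeroʳ _))))
    -- (s²+x)/2s is an upper bound, by AM-GM again.
    upper : 2s * √ x ≤ √ x * √ x + x
    upper = *-monoʳ-≤ 0≤2s (proj₂ (√-isLeastUpperBound x) ((√ x * √ x + x) / 2s) bound) ⟨≤⟩
      ≈⇒≤ (/-inverse 2s≉0)
      where
      bound : IsUpperBound (SqrtSet x) ((√ x * √ x + x) / 2s)
      bound y (inj₁ y≤0) = y≤0 ⟨≤⟩ *-nonNeg (+-nonNeg (0≤x*x _) 0≤x) (⁻¹-nonNeg 2s≉0 0≤2s)
      bound y (inj₂ y²≤x) = *-cancelˡ-≤ 2s≉0 0≤2s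
        (0≤y-x⇒x≤y (0≤x*x (√ x - y) ⟨≤⟩
           ≈⇒≤ (solve 2 (λ s y → (s :- y) :* (s :- y) := s :* s :+ y :* y :- con (+ 2) :* s :* y)
                  refl (√ x) y)) ⟨≤⟩
         +-mono-≤ ≤-refl y²≤x ⟨≤⟩ ≈⇒≤ (sym (/-inverse 2s≉0)))

  √-unique : ∀ {x y} → 0# ≤ y → y * y ≈ x → √ x ≈ y
  √-unique {x} {y} 0≤y y²≈x = square-cancel-≈ (√-nonNeg x) 0≤y
    (trans (√-square (0≤x*x y ⟨≤⟩ ≈⇒≤ y²≈x)) (sym y²≈x))

-- Expected numbers of events under a finitely additive probability.

count : List Bool → ℕ
count []           = 0
count (true ∷ bs)  = suc (count bs)
count (false ∷ bs) = count bs

module Counting (ℝ : Reals) (G : Group 0ℓ 0ℓ) (P : Plane.LeftInvariantProbability ℝ G) where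
  open Reals ℝ
  open OrderedField ℝ
  open Plane ℝ using (module Subset; module LeftInvariantProbability)
  open LeftInvariantProbability P
  open Solver using (solve; _:=_; _:+_; _:*_; con)
  private module G = Group G

  -- Boolean values, in contrast to the predicates of `Subset`, give complements and allow the
  -- events that hold at a group element to be counted.
  record Event : Set where
    field
      holds : G.Carrier → Bool
      resp  : ∀ {g h} → g G.≈ h → holds g ≡ holds h

  open Event public

  subset : Event → Plane.Subset ℝ G
  subset E = record
    { pred = λ g → T (holds E g)
    ; resp = λ g≈h → ≡.subst T (resp E g≈h)
    }

  prob : Event → Carrier
  prob E = μ (subset E)

  prob-cong : ∀ E F → (∀ g → holds E g ≡ holds F g) → prob E ≈ prob F
  prob-cong E F E≗F = μ-cong _ _ ((λ {g} → ≡.subst T (E≗F g)) , (λ {g} → ≡.subst T (≡.sym (E≗F g))))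

  always : Event
  always = record { holds = λ _ → true ; resp = λ _ → ≡.refl }

  prob-always : prob always ≈ 1#
  prob-always = trans (μ-cong _ _ ((λ _ → tt) , (λ _ → tt))) normalised

  _and_ : Event → Event → Event
  E and F = record
    { holds = λ g → holds E g ∧ holds F g
    ; resp  = λ g≈h → ≡.cong₂ _∧_ (resp E g≈h) (resp F g≈h)
    }

  complement : Event → Event
  complement E = record
    { holds = λ g → not (holds E g)
    ; resp  = λ g≈h → ≡.cong not (resp E g≈h)
    }

  prob-split : ∀ E F → prob E ≈ prob (E and F) + prob (E and complement F)
  prob-split E F = trans
    (μ-cong _ _ ((λ {g} → join (holds E g) (holds F g)) , (λ {g} → split (holds E g) (holds F g))))
    (additive _ _ (λ {g} → disjoint (holds E g) (holds F g)))
    where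
    join : ∀ a b → T a → T (a ∧ b) ⊎ T (a ∧ not b)
    join true true  _ = inj₁ tt
    join true false _ = inj₂ tt
    split : ∀ a b → T (a ∧ b) ⊎ T (a ∧ not b) → T a
    split true b _ = tt
    split false b (inj₁ ())
    split false b (inj₂ ())
    disjoint : ∀ a b → ¬ (T (a ∧ b) × T (a ∧ not b))
    disjoint true true  (_ , ())
    disjoint true false (() , _)
    disjoint false b    (() , _)

  -- An empty event is disjoint from itself and equal to its union with itself, so additivity gives
  -- twice its probability.
  prob-empty : ∀ E → (∀ g → ¬ T (holds E g)) → prob E ≈ 0#
  prob-empty E empty = antisym
    (+-cancelʳ-≤ (prob E) (≈⇒≤ (trans (sym (trans
      (μ-cong _ _ (inj₁ , λ { (inj₁ p) → p ; (inj₂ p) → p }))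
      (additive (subset E) (subset E) (λ {g} p → empty g (proj₁ p)))))
      (sym (+-identityˡ _)))))
    (nonNegative _)

  -- The integral over `H` of k plus the number of events in the list that hold, written as a finite
  -- sum. The constant k absorbs the events already known to hold on `H`.
  weight : ℕ → Event → List Event → Carrier
  weight k H []       = fromℕ k * prob H
  weight k H (E ∷ Es) = prob (H and E) + weight k H Es

  countAt : List Event → G.Carrier → ℕ
  countAt Es g = count (List.map (λ E → holds E g) Es)

  private
    swap-and : ∀ H E F → prob ((H and F) and E) ≈ prob ((H and E) and F)
    swap-and H E F = prob-cong ((H and F) and E) ((H and E) and F)
      (λ g → lemma (holds H g) (holds E g) (holds F g))
      where
      lemma : ∀ h e f → (h ∧ f) ∧ e ≡ (h ∧ e) ∧ f
      lemma true  true  true  = ≡.refl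
      lemma true  true  false = ≡.refl
      lemma true  false true  = ≡.refl
      lemma true  false false = ≡.refl
      lemma false e     f     = ≡.refl

    weight-split : ∀ k H Es F → weight k H Es ≈ weight k (H and F) Es + weight k (H and complement F) Es
    weight-split k H [] F = trans (*-congˡ (prob-split H F)) (distribˡ _ _ _)
    weight-split k H (E ∷ Es) F = trans
      (+-cong (trans (prob-split (H and E) F)
                     (+-cong (sym (swap-and H E F)) (sym (swap-and H E (complement F)))))
              (weight-split k H Es F))
      (solve 4 (λ a b c d → (a :+ b) :+ (c :+ d) := (a :+ c) :+ (b :+ d)) refl _ _ _ _)

    weight-suc : ∀ k H Es → prob H + weight k H Es ≈ weight (suc k) H Es
    weight-suc k H [] = trans (+-congʳ (sym (*-identityˡ _))) (sym (distribʳ _ _ _))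
    weight-suc k H (E ∷ Es) = trans
      (solve 3 (λ a b c → a :+ (b :+ c) := b :+ (a :+ c)) refl _ _ _)
      (+-congˡ (weight-suc k H Es))

    weight-∷ : ∀ k H E Es →
      weight k H (E ∷ Es) ≈ weight (suc k) (H and E) Es + weight k (H and complement E) Es
    weight-∷ k H E Es = trans (+-congˡ (weight-split k H Es E))
      (trans (sym (+-assoc _ _ _)) (+-congʳ (weight-suc k (H and E) Es)))

    given : ∀ {a b} → T (a ∧ b) → T a × T b
    given = Equivalence.to T-∧

    count-true : ∀ b bs → T b → count (b ∷ bs) ≡ suc (count bs)
    count-true true bs _ = ≡.refl

    count-false : ∀ b bs → T (not b) → count (b ∷ bs) ≡ count bs
    count-false false bs _ = ≡.refl

    -- Each event in turn splits `H` into two pieces on which it is decided, and its contribution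
    -- moves into k or l. Once both lists are exhausted, either k ≤ l, or the hypothesis shows that
    -- the piece is empty and both sides vanish.
    weight-mono : ∀ k l Es Fs H →
      (∀ g → T (holds H g) → k ℕ.+ countAt Es g ℕ.≤ l ℕ.+ countAt Fs g) →
      weight k H Es ≤ weight l H Fs
    weight-mono k l (E ∷ Es) Fs H le =
      ≈⇒≤ (weight-∷ k H E Es) ⟨≤⟩
      +-mono-≤ (weight-mono (suc k) l Es Fs (H and E) le₁)
               (weight-mono k l Es Fs (H and complement E) le₀) ⟨≤⟩
      ≈⇒≤ (sym (weight-split l H Fs E))
      where
      le₁ : ∀ g → T (holds (H and E) g) → suc k ℕ.+ countAt Es g ℕ.≤ l ℕ.+ countAt Fs g
      le₁ g p with h , e ← given p = ≡.subst (ℕ._≤ l ℕ.+ countAt Fs g)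
        (≡.trans (≡.cong (k ℕ.+_) (count-true (holds E g) _ e)) (ℕ.+-suc k _)) (le g h)
      le₀ : ∀ g → T (holds (H and complement E) g) → k ℕ.+ countAt Es g ℕ.≤ l ℕ.+ countAt Fs g
      le₀ g p with h , e ← given p = ≡.subst (ℕ._≤ l ℕ.+ countAt Fs g)
        (≡.cong (k ℕ.+_) (count-false (holds E g) _ e)) (le g h)
    weight-mono k l [] (F ∷ Fs) H le =
      ≈⇒≤ (weight-split k H [] F) ⟨≤⟩
      +-mono-≤ (weight-mono k (suc l) [] Fs (H and F) le₁)
               (weight-mono k l [] Fs (H and complement F) le₀) ⟨≤⟩
      ≈⇒≤ (sym (weight-∷ l H F Fs))
      where
      le₁ : ∀ g → T (holds (H and F) g) → k ℕ.+ 0 ℕ.≤ suc l ℕ.+ countAt Fs g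
      le₁ g p with h , f ← given p = ≡.subst (k ℕ.+ 0 ℕ.≤_)
        (≡.trans (≡.cong (l ℕ.+_) (count-true (holds F g) _ f)) (ℕ.+-suc l _)) (le g h)
      le₀ : ∀ g → T (holds (H and complement F) g) → k ℕ.+ 0 ℕ.≤ l ℕ.+ countAt Fs g
      le₀ g p with h , f ← given p = ≡.subst (k ℕ.+ 0 ℕ.≤_)
        (≡.cong (l ℕ.+_) (count-false (holds F g) _ f)) (le g h)
    weight-mono k l [] [] H le with k ℕ.≤? l
    ... | yes k≤l = *-mono-≤ (fromℕ-nonNeg k) (nonNegative _) (fromℕ-mono-≤ k≤l) ≤-refl
    ... | no  k≰l = ≈⇒≤ (trans (*-congˡ H≈0) (trans (zeroʳ _) (sym (trans (*-congˡ H≈0) (zeroʳ _)))))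
      where
      H≈0 : prob H ≈ 0#
      H≈0 = prob-empty H (λ g h → k≰l (≡.subst₂ ℕ._≤_ (ℕ.+-identityʳ k) (ℕ.+-identityʳ l) (le g h)))

  expectation : List Event → Carrier
  expectation []       = 0#
  expectation (E ∷ Es) = prob E + expectation Es

  private
    weight-expectation : ∀ Es → weight 0 always Es ≈ expectation Es
    weight-expectation []       = zeroˡ _
    weight-expectation (E ∷ Es) = +-cong (prob-cong (always and E) E (λ _ → ≡.refl)) (weight-expectation Es)

  expectation-mono : ∀ Es Fs → (∀ g → countAt Es g ℕ.≤ countAt Fs g) → expectation Es ≤ expectation Fs
  expectation-mono Es Fs le =
    ≈⇒≤ (sym (weight-expectation Es)) ⟨≤⟩
    weight-mono 0 0 Es Fs always (λ g _ → le g) ⟨≤⟩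
    ≈⇒≤ (weight-expectation Fs)

-- Isometries of the plane and isosceles triangles with base 1.

module PlaneGeometry (ℝ : Reals) where
  open Reals ℝ
  open OrderedField ℝ
  open Plane ℝ hiding (p)
  open Solver using (solve; _:=_; _:+_; _:*_; _:-_; :-_; con)
  open Setoid ℂ using () renaming (refl to ≈ᶜ-refl; sym to ≈ᶜ-sym; trans to ≈ᶜ-trans)

  infixl 6 _⊕_ _⊖_
  infixl 7 _⊛_

  _⊕_ _⊖_ _⊛_ : Point → Point → Point
  (x₁ , y₁) ⊕ (x₂ , y₂) = x₁ + x₂ , y₁ + y₂
  (x₁ , y₁) ⊖ (x₂ , y₂) = x₁ - x₂ , y₁ - y₂
  (x₁ , y₁) ⊛ (x₂ , y₂) = x₁ * x₂ - y₁ * y₂ , x₁ * y₂ + y₁ * x₂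

  normSq : Point → Carrier
  normSq (x , y) = x * x + y * y

  normSq-cong : ∀ {z w} → z ≈ᶜ w → normSq z ≈ normSq w
  normSq-cong (p , q) = +-cong (*-cong p p) (*-cong q q)

  ⊖-cong : ∀ {z z′ w w′} → z ≈ᶜ z′ → w ≈ᶜ w′ → z ⊖ w ≈ᶜ z′ ⊖ w′
  ⊖-cong (p , q) (r , s) = +-cong p (-‿cong r) , +-cong q (-‿cong s)

  ⊕-cong : ∀ {z z′ w w′} → z ≈ᶜ z′ → w ≈ᶜ w′ → z ⊕ w ≈ᶜ z′ ⊕ w′
  ⊕-cong (p , q) (r , s) = +-cong p r , +-cong q s

  ⊛-congˡ : ∀ {z w w′} → w ≈ᶜ w′ → z ⊛ w ≈ᶜ z ⊛ w′
  ⊛-congˡ (p , q) = +-cong (*-congˡ p) (-‿cong (*-congˡ q)) , +-cong (*-congˡ q) (*-congˡ p)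

  normSq-nonNeg : ∀ z → 0# ≤ normSq z
  normSq-nonNeg (x , y) = +-nonNeg (0≤x*x x) (0≤x*x y)

  normSq≈0 : ∀ {z} → normSq z ≈ 0# → z ≈ᶜ (0# , 0#)
  normSq≈0 {x , y} eq =
    square≈0 (≈⇒≤ (sym (+-identityʳ _)) ⟨≤⟩ +-monoʳ-≤ _ (0≤x*x y) ⟨≤⟩ ≈⇒≤ eq) ,
    square≈0 (≈⇒≤ (sym (+-identityˡ _)) ⟨≤⟩ +-mono-≤ (0≤x*x x) ≤-refl ⟨≤⟩ ≈⇒≤ eq)

  normSq⇒dist : ∀ {A B d} → 0# ≤ d → normSq (A ⊖ B) ≈ d * d → dist A B ≈ d
  normSq⇒dist 0≤d eq = √-unique 0≤d (sym eq)

  dist⇒normSq : ∀ {A B d} → dist A B ≈ d → normSq (A ⊖ B) ≈ d * d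
  dist⇒normSq {A} {B} eq = trans (sym (√-square (normSq-nonNeg (A ⊖ B)))) (*-cong eq eq)

  rotation : ∀ ρ → normSq ρ ≈ fromℕ 1 → Point → Isometry
  rotation (a , b) unit (s , t) = record
    { bijection = record
      { to        = to
      ; from      = from
      ; to-cong   = to-cong
      ; from-cong = from-cong
      ; inverse   = (λ y≈ → ≈ᶜ-trans (to-cong y≈) (invˡ _)) ,
                    (λ y≈ → ≈ᶜ-trans (from-cong y≈) (invʳ _))
      }
    ; isometric = λ { A@(x₁ , y₁) B@(x₂ , y₂) → √-cong (trans (solve 8 (λ a b s t x₁ y₁ x₂ y₂ →
        let X = (a :* x₁ :- b :* y₁ :+ s) :- (a :* x₂ :- b :* y₂ :+ s)
            Y = (a :* y₁ :+ b :* x₁ :+ t) :- (a :* y₂ :+ b :* x₂ :+ t)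
            x = x₁ :- x₂
            y = y₁ :- y₂
        in X :* X :+ Y :* Y := (a :* a :+ b :* b) :* (x :* x :+ y :* y)) refl a b s t x₁ y₁ x₂ y₂)
        (trans (*-congʳ unit) (trans (*-congʳ fromℕ-1) (*-identityˡ _)))) }
    }
    where
    to from : Point → Point
    to z = (a , b) ⊛ z ⊕ (s , t)
    -- The inverse of a unit complex number is its conjugate.
    from z = (a , - b) ⊛ (z ⊖ (s , t))
    to-cong : ∀ {z w} → z ≈ᶜ w → to z ≈ᶜ to w
    to-cong z≈w = ⊕-cong (⊛-congˡ z≈w) ≈ᶜ-refl
    from-cong : ∀ {z w} → z ≈ᶜ w → from z ≈ᶜ from w
    from-cong z≈w = ⊛-congˡ (⊖-cong z≈w ≈ᶜ-refl)
    scaled : ∀ x → (a * a + b * b) * x ≈ x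
    scaled x = trans (*-congʳ unit) (trans (*-congʳ fromℕ-1) (*-identityˡ x))
    invˡ : ∀ z → to (from z) ≈ᶜ z
    invˡ (x , y) =
      trans (solve 6 (λ a b s t x y →
        a :* (a :* (x :- s) :- :- b :* (y :- t)) :- b :* (a :* (y :- t) :+ :- b :* (x :- s)) :+ s :=
        (a :* a :+ b :* b) :* (x :- s) :+ s) refl a b s t x y)
      (trans (+-congʳ (scaled _)) (solve 2 (λ x s → x :- s :+ s := x) refl x s)) ,
      trans (solve 6 (λ a b s t x y →
        a :* (a :* (y :- t) :+ :- b :* (x :- s)) :+ b :* (a :* (x :- s) :- :- b :* (y :- t)) :+ t :=
        (a :* a :+ b :* b) :* (y :- t) :+ t) refl a b s t x y)
      (trans (+-congʳ (scaled _)) (solve 2 (λ x s → x :- s :+ s := x) refl y t))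
    invʳ : ∀ z → from (to z) ≈ᶜ z
    invʳ (x , y) =
      trans (solve 6 (λ a b s t x y →
        a :* ((a :* x :- b :* y :+ s) :- s) :- :- b :* ((a :* y :+ b :* x :+ t) :- t) :=
        (a :* a :+ b :* b) :* x) refl a b s t x y) (scaled x) ,
      trans (solve 6 (λ a b s t x y →
        a :* ((a :* y :+ b :* x :+ t) :- t) :+ :- b :* ((a :* x :- b :* y :+ s) :- s) :=
        (a :* a :+ b :* b) :* y) refl a b s t x y) (scaled y)

  pointReflection : Point → Isometry
  pointReflection = rotation (- fromℕ 1 , 0#) (solve 0
    (:- con (+ 1) :* :- con (+ 1) :+ con (+ 0) :* con (+ 0) := con (+ 1)) refl)

  congruent : ∀ A B A′ B′ → normSq (B ⊖ A) ≈ normSq (B′ ⊖ A′) →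
    ∃ λ φ → Isometry.to φ A ≈ᶜ A′ × Isometry.to φ B ≈ᶜ B′
  congruent A@(x , y) B@(u , v) A′@(x′ , y′) B′@(u′ , v′) eq with normSq (B ⊖ A) ≟ 0#
  -- If A = B, the quotient used below is undefined, but a translation suffices. This case occurs
  -- for d = 0.
  ... | yes z≈0 = rotation (fromℕ 1 , 0#)
      (solve 0 (con (+ 1) :* con (+ 1) :+ con (+ 0) :* con (+ 0) := con (+ 1)) refl) (A′ ⊖ A) ,
      (first x y x′ , second x y y′) ,
      (trans (first′ u v x x′) (trans (+-congˡ (proj₁ u≈x)) (trans (+-identityʳ x′) (sym (close (proj₁ u≈x′))))) ,
       trans (second′ u v y y′) (trans (+-congˡ (proj₂ u≈x)) (trans (+-identityʳ y′) (sym (close (proj₂ u≈x′))))))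
    where
    u≈x = normSq≈0 {B ⊖ A} z≈0
    u≈x′ = normSq≈0 {B′ ⊖ A′} (trans (sym eq) z≈0)
    close : ∀ {x y} → y - x ≈ 0# → y ≈ x
    close {x} {y} e = trans (solve 2 (λ x y → y := (y :- x) :+ x) refl x y)
      (trans (+-congʳ e) (+-identityˡ x))
    first : ∀ x y x′ → fromℕ 1 * x - 0# * y + (x′ - x) ≈ x′
    first = solve 3 (λ x y x′ → con (+ 1) :* x :- con (+ 0) :* y :+ (x′ :- x) := x′) refl
    second : ∀ x y y′ → fromℕ 1 * y + 0# * x + (y′ - y) ≈ y′
    second = solve 3 (λ x y y′ → con (+ 1) :* y :+ con (+ 0) :* x :+ (y′ :- y) := y′) refl
    first′ : ∀ u v x x′ → fromℕ 1 * u - 0# * v + (x′ - x) ≈ x′ + (u - x)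
    first′ = solve 4 (λ u v x x′ → con (+ 1) :* u :- con (+ 0) :* v :+ (x′ :- x) := x′ :+ (u :- x)) refl
    second′ : ∀ u v y y′ → fromℕ 1 * v + 0# * u + (y′ - y) ≈ y′ + (v - y)
    second′ = solve 4 (λ u v y y′ → con (+ 1) :* v :+ con (+ 0) :* u :+ (y′ :- y) := y′ :+ (v :- y)) refl
  ... | no z≉0 = rotation ρ unit (A′ ⊖ ρ ⊛ A) ,
      (solve 2 (λ p x′ → p :+ (x′ :- p) := x′) refl _ x′ , solve 2 (λ p y′ → p :+ (y′ :- p) := y′) refl _ y′) ,
      (trans (solve 9 (λ u v x y x′ y′ p q i →
         let a = p :* i ; b = q :* i in
         a :* u :- b :* v :+ (x′ :- (a :* x :- b :* y)) := (p :* (u :- x) :- q :* (v :- y)) :* i :+ x′)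
         refl u v x y x′ y′ p q i)
       (trans (+-congʳ (trans (*-congʳ (solve 4 (λ X Y X′ Y′ →
         (X′ :* X :+ Y′ :* Y) :* X :- (Y′ :* X :- X′ :* Y) :* Y := X′ :* (X :* X :+ Y :* Y)) refl X Y X′ Y′))
         (divide X′))) (solve 2 (λ u x → u :- x :+ x := u) refl u′ x′))) ,
      trans (solve 9 (λ u v x y x′ y′ p q i →
         let a = p :* i ; b = q :* i in
         a :* v :+ b :* u :+ (y′ :- (a :* y :+ b :* x)) := (p :* (v :- y) :+ q :* (u :- x)) :* i :+ y′)
         refl u v x y x′ y′ p q i)
       (trans (+-congʳ (trans (*-congʳ (solve 4 (λ X Y X′ Y′ →
         (X′ :* X :+ Y′ :* Y) :* Y :+ (Y′ :* X :- X′ :* Y) :* X := Y′ :* (X :* X :+ Y :* Y)) refl X Y X′ Y′))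
         (divide Y′))) (solve 2 (λ u x → u :- x :+ x := u) refl v′ y′))
    where
    -- ρ = (B′ - A′)/(B - A)
    X = u - x ; Y = v - y ; X′ = u′ - x′ ; Y′ = v′ - y′
    n = normSq (B ⊖ A)
    i = n ⁻¹
    p = X′ * X + Y′ * Y
    q = Y′ * X - X′ * Y
    ρ = p * i , q * i
    ni : n * i ≈ fromℕ 1
    ni = trans (⁻¹-inverseʳ n z≉0) (sym fromℕ-1)
    divide : ∀ z → z * n * i ≈ z
    divide z = trans (*-assoc z n i) (trans (*-congˡ ni) (trans (*-congˡ fromℕ-1) (*-identityʳ z)))
    unit : normSq ρ ≈ fromℕ 1
    unit = trans (solve 5 (λ X Y X′ Y′ i →
      let p = X′ :* X :+ Y′ :* Y ; q = Y′ :* X :- X′ :* Y in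
      p :* i :* (p :* i) :+ q :* i :* (q :* i) :=
      ((X :* X :+ Y :* Y) :* i) :* ((X′ :* X′ :+ Y′ :* Y′) :* i)) refl X Y X′ Y′ i)
      (trans (*-cong ni (trans (*-congʳ (sym eq)) ni)) (solve 0 (con (+ 1) :* con (+ 1) := con (+ 1)) refl))

  spindle : ∀ A B → fromℕ 1 ≤ fromℕ 4 * normSq (B ⊖ A) →
    ∃ λ C → normSq (C ⊖ A) ≈ normSq (B ⊖ A) × normSq (C ⊖ B) ≈ fromℕ 1
  -- C is B turned about A by the angle with cosine 1 - 1/(2|B - A|²).
  spindle A@(x , y) B@(u , v) 1≤4s = (x + X , y + Y) ,
    trans (solve 6 (λ x y c t U V →
      let X = c :* U :- t :* V ; Y = c :* V :+ t :* U ; X′ = x :+ X :- x ; Y′ = y :+ Y :- y in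
      X′ :* X′ :+ Y′ :* Y′ := (c :* c :+ t :* t) :* (U :* U :+ V :* V)) refl x y c t U V)
      (trans (*-congʳ unit) (trans (*-congʳ fromℕ-1) (*-identityˡ s))) ,
    trans (solve 6 (λ x y t i u v →
      let U = u :- x ; V = v :- y ; c = con (+ 1) :- i
          X = x :+ (c :* U :- t :* V) :- u ; Y = y :+ (c :* V :+ t :* U) :- v in
      X :* X :+ Y :* Y := (i :* i :+ t :* t) :* (U :* U :+ V :* V)) refl x y t i u v)
    (trans (*-congʳ (trans (+-congˡ t²) (solve 1 (λ i → i :* i :+ i :* (con (+ 2) :- i) := con (+ 2) :* i) refl i)))
    (trans (solve 2 (λ s i → con (+ 2) :* i :* s := con (+ 2) :* s :* i) refl s i) 2si))
    where
    U = u - x ; V = v - y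
    s = normSq (B ⊖ A)
    2s≉0 : ¬ fromℕ 2 * s ≈ 0#
    2s≉0 eq = fromℕ-suc≉0 0 (antisym (1≤4s ⟨≤⟩
      ≈⇒≤ (trans (solve 1 (λ s → con (+ 4) :* s := con (+ 2) :* (con (+ 2) :* s)) refl s)
                 (trans (*-congˡ eq) (zeroʳ _)))) (fromℕ-nonNeg 1))
    i = (fromℕ 2 * s) ⁻¹
    0≤i : 0# ≤ i
    0≤i = ⁻¹-nonNeg 2s≉0 (*-nonNeg (fromℕ-nonNeg 2) (normSq-nonNeg (B ⊖ A)))
    2si : fromℕ 2 * s * i ≈ fromℕ 1
    2si = trans (⁻¹-inverseʳ _ 2s≉0) (sym fromℕ-1)
    -- Here |AB| ≥ 1/2 enters: the cosine 1 - i has to be at least -1.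
    i≤2 : i ≤ fromℕ 2
    i≤2 = ≈⇒≤ (solve 1 (λ i → i := i :* con (+ 1)) refl i) ⟨≤⟩ *-monoʳ-≤ 0≤i 1≤4s ⟨≤⟩
      ≈⇒≤ (trans (solve 2 (λ s i → i :* (con (+ 4) :* s) := con (+ 2) :* (con (+ 2) :* s :* i)) refl s i)
        (trans (*-congˡ 2si) (solve 0 (con (+ 2) :* con (+ 1) := con (+ 2)) refl)))
    c = fromℕ 1 - i
    t = √ (i * (fromℕ 2 - i))
    X = c * U - t * V
    Y = c * V + t * U
    t² : t * t ≈ i * (fromℕ 2 - i)
    t² = √-square (*-nonNeg 0≤i (x≤y⇒0≤y-x i≤2))
    unit : c * c + t * t ≈ fromℕ 1
    unit = trans (+-congˡ t²) (solve 1 (λ i →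
      (con (+ 1) :- i) :* (con (+ 1) :- i) :+ i :* (con (+ 2) :- i) := con (+ 1)) refl i)

-- Events determined by the colours of finitely many points.

Colours : ℕ → Set
Colours = Vec (Fin 4)

differ : Colours 2 → Bool
differ (a ∷ b ∷ []) = not ⌊ a Fin.≟ b ⌋

same : Colours 2 → Bool
same (a ∷ b ∷ []) = ⌊ a Fin.≟ b ⌋

rainbow : Colours 3 → Bool
rainbow (a ∷ b ∷ c ∷ []) = differ (a ∷ b ∷ []) ∧ differ (b ∷ c ∷ []) ∧ differ (c ∷ a ∷ [])

module ColourEvents
  (ℝ : Reals) (c₀ : Plane.Colouring ℝ) (μ : Plane.LeftInvariantProbability ℝ (Plane.S₄×E₂ ℝ)) where

  open Reals ℝ
  open OrderedField ℝ
  open Plane ℝ hiding (p)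
  open PlaneGeometry ℝ
  private module G = Group S₄×E₂
  open Counting ℝ S₄×E₂ μ public
  open LeftInvariantProbability μ using (μ-cong; leftInvariant)
  open Setoid ℂ using () renaming (refl to ≈ᶜ-refl; sym to ≈ᶜ-sym)

  colour : G.Carrier → Point → Fin 4
  colour = recolour c₀

  colour-cong : ∀ g {A B} → A ≈ᶜ B → colour g A ≡ colour g B
  colour-cong (σ , φ) A≈B = ≡.cong (Inverse.to σ) (Func.cong c₀ (Isometry.from-cong φ A≈B))

  colour-resp : ∀ {g h} → g G.≈ h → ∀ A → colour g A ≡ colour h A
  colour-resp {σ , S} {τ , R} (σ≈τ , S≈R) A = ≡.trans (σ≈τ _)
    (≡.cong (Inverse.to τ) (Func.cong c₀ (Group.⁻¹-cong E₂ {S} {R} S≈R A)))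

  colour-proper : Proper c₀ → ∀ g {A B} → normSq (B ⊖ A) ≈ fromℕ 1 → colour g B ≢ colour g A
  colour-proper proper (σ , φ) {A} {B} unit same = proper (from φ B) (from φ A)
    (trans (Isometry.isometric (Group._⁻¹ E₂ φ) B A)
      (normSq⇒dist (0≤x*x 1# ⟨≤⟩ ≈⇒≤ (*-identityˡ 1#))
        (trans unit (trans fromℕ-1 (sym (*-identityˡ 1#))))))
    (≡.trans (≡.sym (Inverse.strictlyInverseʳ σ _))
      (≡.trans (≡.cong (Inverse.from σ) same) (Inverse.strictlyInverseʳ σ _)))
    where open Isometry using (from)

  colourEvent : ∀ {n} → (Colours n → Bool) → Vec Point n → Event
  colourEvent Q As = record
    { holds = λ g → Q (Vec.map (colour g) As)
    ; resp  = λ {g} {h} g≈h → ≡.cong Q (Vec.map-cong (colour-resp {g} {h} g≈h) As)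
    }

  colourEvent-cong : ∀ {n} (Q : Colours n → Bool) {As Bs} → Pointwise _≈ᶜ_ As Bs →
    prob (colourEvent Q As) ≈ prob (colourEvent Q Bs)
  colourEvent-cong Q As≈Bs =
    prob-cong (colourEvent Q _) (colourEvent Q _) (λ g → ≡.cong Q (colours-cong g As≈Bs))
    where
    colours-cong : ∀ {n} g {As Bs : Vec Point n} → Pointwise _≈ᶜ_ As Bs →
      Vec.map (colour g) As ≡ Vec.map (colour g) Bs
    colours-cong g []            = ≡.refl
    colours-cong g (A≈B ∷ As≈Bs) = ≡.cong₂ _∷_ (colour-cong g A≈B) (colours-cong g As≈Bs)

  -- With g = (id, φ), the colouring of g ∙ e at φ(A) is that of e at A. The event for the moved
  -- points is therefore the left translate by g of the event for the original ones.
  colourEvent-invariant : ∀ {n} (Q : Colours n → Bool) As φ →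
    prob (colourEvent Q (Vec.map (Isometry.to φ) As)) ≈ prob (colourEvent Q As)
  colourEvent-invariant Q As φ = trans (μ-cong _ _ ((λ {h} → pull h) , (λ {h} → push h)))
    (leftInvariant g (subset (colourEvent Q As)))
    where
    g : G.Carrier
    g = Group.ε S₄ , φ
    push : ∀ h → (∃ λ e → T (Q (Vec.map (colour e) As)) × (h G.≈ g G.∙ e)) →
      T (Q (Vec.map (colour h) (Vec.map (Isometry.to φ) As)))
    push h (e , Qe , h≈ge) = ≡.subst (T ∘ Q)
      (≡.trans (Vec.map-cong (λ A → ≡.trans
        (≡.sym (colour-cong e (Isometry.strictlyInverseʳ φ A)))
        (≡.sym (colour-resp {h} {g G.∙ e} h≈ge (Isometry.to φ A)))) As)
        (Vec.map-∘ (colour h) (Isometry.to φ) As)) Qe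
    pull : ∀ h → T (Q (Vec.map (colour h) (Vec.map (Isometry.to φ) As))) →
      (∃ λ e → T (Q (Vec.map (colour e) As)) × (h G.≈ g G.∙ e))
    pull h Qh = g G.⁻¹ G.∙ h ,
      ≡.subst (T ∘ Q) (≡.sym (Vec.map-∘ (colour h) (Isometry.to φ) As)) Qh ,
      ((λ _ → ≡.refl) , (λ A → ≈ᶜ-sym (Isometry.strictlyInverseˡ φ (Isometry.to (proj₂ h) A))))

  congruent-prob : ∀ Q {A B A′ B′} → normSq (B ⊖ A) ≈ normSq (B′ ⊖ A′) →
    prob (colourEvent Q (A ∷ B ∷ [])) ≈ prob (colourEvent Q (A′ ∷ B′ ∷ []))
  congruent-prob Q {A} {B} {A′} {B′} eq with φ , φA , φB ← congruent A B A′ B′ eq = trans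
    (sym (colourEvent-invariant Q (A ∷ B ∷ []) φ))
    (colourEvent-cong Q (φA ∷ φB ∷ []))

  p≈prob : ∀ A B → Plane.p ℝ c₀ μ A B ≈ prob (colourEvent same (A ∷ B ∷ []))
  p≈prob A B = μ-cong _ _
    ((λ {g} → toSame (colour g A) (colour g B)) , (λ {g} → fromSame (colour g A) (colour g B)))
    where
    toSame : ∀ a b → a ≡ b → T (same (a ∷ b ∷ []))
    toSame a b a≡b with a Fin.≟ b
    ... | yes _  = tt
    ... | no a≢b = contradiction a≡b a≢b
    fromSame : ∀ a b → T (same (a ∷ b ∷ [])) → a ≡ b
    fromSame a b t with a Fin.≟ b
    ... | yes a≡b = a≡b

  -- Take C with |AC| = |AB| and |BC| = 1. Then B and C have different colours, so A differs from at
  -- least one of them, while the pairs AB and AC are bichromatic with equal probability by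
  -- congruence.
  bichromatic-half : Proper c₀ → ∀ A B → fromℕ 1 ≤ fromℕ 4 * normSq (B ⊖ A) →
    fromℕ 1 ≤ fromℕ 2 * prob (colourEvent differ (A ∷ B ∷ []))
  bichromatic-half proper A B far = bound (spindle A B far)
    where
    open Solver using (solve; _:=_; _:+_; _:*_; con)
    oneDiffers : ∀ a b c → c ≢ b → 1 ℕ.≤ count (differ (a ∷ b ∷ []) ∷ differ (a ∷ c ∷ []) ∷ [])
    oneDiffers a b c c≢b with a Fin.≟ b | a Fin.≟ c
    ... | yes a≡b | yes a≡c = contradiction (≡.trans (≡.sym a≡c) a≡b) c≢b
    ... | yes _   | no _    = s≤s z≤n
    ... | no _    | yes _   = s≤s z≤n
    ... | no _    | no _    = s≤s z≤n
    half : ∀ {x y z} → x ≈ 1# → y ≈ z → x + 0# ≤ y + (z + 0#) → fromℕ 1 ≤ fromℕ 2 * y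
    half {x} {y} {z} x≈1 y≈z le = ≈⇒≤ (+-congʳ (sym x≈1)) ⟨≤⟩ le ⟨≤⟩
      ≈⇒≤ (trans (+-congˡ (+-congʳ (sym y≈z)))
        (solve 1 (λ y → y :+ (y :+ con (+ 0)) := con (+ 2) :* y) refl y))
    bound : (∃ λ C → normSq (C ⊖ A) ≈ normSq (B ⊖ A) × normSq (C ⊖ B) ≈ fromℕ 1) →
      fromℕ 1 ≤ fromℕ 2 * prob (colourEvent differ (A ∷ B ∷ []))
    bound (C , |AC|≈|AB| , unit) =
      half {prob always} {prob AB} {prob AC} prob-always (congruent-prob differ (sym |AC|≈|AB|))
        (expectation-mono (always ∷ []) (AB ∷ AC ∷ [])
          (λ g → oneDiffers (colour g A) (colour g B) (colour g C) (colour-proper proper g unit)))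
      where
      AB = colourEvent differ (A ∷ B ∷ [])
      AC = colourEvent differ (A ∷ C ∷ [])

-- Integer coordinates for the points.

-- (a , b , c , d) stands for (a + bω)u + (c + dω)v, where ω = e^{iπ/3} and u, v
-- are unit vectors with |u + v| = d.
Coordinates : Set
Coordinates = ℤ × ℤ × ℤ × ℤ

_⊖ᶻ_ : Coordinates → Coordinates → Coordinates
(a , b , c , d) ⊖ᶻ (a′ , b′ , c′ , d′) = a ℤ.- a′ , b ℤ.- b′ , c ℤ.- c′ , d ℤ.- d′

-- multiplication by ω, using ω² = ω - 1
turn : Coordinates → Coordinates
turn (a , b , c , d) = ℤ.- b , a ℤ.+ b , ℤ.- d , c ℤ.+ d

turns : ℕ → Coordinates → List Coordinates
turns zero    z = []
turns (suc n) z = z ∷ turns n (turn z)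

orbit : Coordinates → List Coordinates
orbit = turns 6

_≟ᶻ_ : DecidableEquality Coordinates
_≟ᶻ_ = ≡-dec ℤ._≟_ (≡-dec ℤ._≟_ (≡-dec ℤ._≟_ ℤ._≟_))

_∈?_ : ∀ z zs → Dec (z ∈ zs)
_∈?_ = member? _≟ᶻ_

u v u+v u+ωv u+ω⁻¹v u+u : Coordinates
u      = + 1 , + 0 , + 0 , + 0
v      = + 0 , + 0 , + 1 , + 0
u+v    = + 1 , + 0 , + 1 , + 0
u+ωv   = + 1 , + 0 , + 0 , + 1
-- This uses ω⁻¹ = 1 - ω.
u+ω⁻¹v = + 1 , + 0 , + 1 , -[1+ 0 ]
u+u    = + 2 , + 0 , + 0 , + 0

-- Exhaustive search through proper colourings.

unit? : ∀ z → Dec (z ∈ orbit u ++ orbit v)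
unit? z = z ∈? (orbit u ++ orbit v)

-- Only unit distances along the twelve vectors ωʲu and ωʲv count. They are present for every d, so
-- one search covers all d; further unit distances at special values of d are ignored.
ProperAt : ∀ {n} → Coordinates → Vec Coordinates n → Fin 4 → Colours n → Set
ProperAt z []       c []        = ⊤
ProperAt z (w ∷ ws) c (c′ ∷ cs) = (z ⊖ᶻ w ∈ orbit u ++ orbit v → c ≢ c′) × ProperAt z ws c cs

ProperOn : ∀ {n} → Vec Coordinates n → Colours n → Set
ProperOn []       []       = ⊤
ProperOn (z ∷ zs) (c ∷ cs) = ProperAt z zs c cs × ProperOn zs cs

adjacency : ∀ {n} → Coordinates → Vec Coordinates n → Vec Bool n
adjacency z = Vec.map (λ w → ⌊ unit? (z ⊖ᶻ w) ⌋)

clash : ∀ {n} → Vec Bool n → Fin 4 → Colours n → Bool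
clash []           c []        = false
clash (false ∷ as) c (c′ ∷ cs) = clash as c cs
clash (true ∷ as)  c (c′ ∷ cs) = same (c ∷ c′ ∷ []) ∨ clash as c cs

everyColour : (Fin 4 → Bool) → Bool
everyColour Q = Q 0F ∧ Q 1F ∧ Q 2F ∧ Q 3F

-- The tail is coloured before the head, so `Q` acts as a continuation that colours the earlier
-- points, and the disjunction abandons a branch at its first clash. Passing the adjacency row to
-- `extend` lets it be computed once and shared by all colourings of the tail.
everyProper : ∀ {n} → Vec Coordinates n → (Colours n → Bool) → Bool
everyProper []       Q = Q []
everyProper (z ∷ zs) Q = extend (adjacency z zs)
  where
  extend : Vec Bool _ → Bool
  extend as = everyProper zs (λ cs → everyColour (λ c → clash as c cs ∨ Q (c ∷ cs)))

everyColour-sound : ∀ Q → T (everyColour Q) → ∀ c → T (Q c)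
everyColour-sound Q h with h₀ , h′ ← Equivalence.to T-∧ h with h₁ , h″ ← Equivalence.to T-∧ h′
  with h₂ , h₃ ← Equivalence.to T-∧ h″ = λ where
    0F → h₀
    1F → h₁
    2F → h₂
    3F → h₃

proper⇒¬clash : ∀ {n} z (zs : Vec Coordinates n) c cs → ProperAt z zs c cs →
  clash (adjacency z zs) c cs ≡ false
proper⇒¬clash z []       c []        _ = ≡.refl
proper⇒¬clash z (w ∷ ws) c (c′ ∷ cs) (c≢ , proper) with unit? (z ⊖ᶻ w)
... | no _ = proper⇒¬clash z ws c cs proper
... | yes w∈ with c Fin.≟ c′
...   | yes c≡c′ = contradiction c≡c′ (c≢ w∈)
...   | no _     = proper⇒¬clash z ws c cs proper

everyProper-sound : ∀ {n} (zs : Vec Coordinates n) Q → everyProper zs Q ≡ true →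
  ∀ cs → ProperOn zs cs → T (Q cs)
everyProper-sound []       Q h []       _ = Equivalence.from T-≡ h
everyProper-sound (z ∷ zs) Q h (c ∷ cs) (proper , propers) =
  ≡.subst (λ b → T (b ∨ Q (c ∷ cs))) (proper⇒¬clash z zs c cs proper)
    (everyColour-sound (λ c → clash (adjacency z zs) c cs ∨ Q (c ∷ cs))
      (everyProper-sound zs _ h cs propers) c)

-- A test together with the indices it reads can be evaluated on a colouring of the finite
-- configuration and can also be turned into an event on the group. This connects the finite check
-- to the measure.
record Observable (n : ℕ) : Set where
  constructor _on_
  field
    {k}    : ℕ
    test   : Colours k → Bool
    points : Vec (Fin n) k

  value : Colours n → Bool
  value cs = test (Vec.map (lookup cs) points)

open Observable public

certain : ∀ {n} → Observable n
certain = (λ _ → true) on []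

tally : ∀ {n} → List (Observable n) → Colours n → ℕ
tally Os cs = count (List.map (λ O → value O cs) Os)

tally-++ : ∀ {n} (Os Ps : List (Observable n)) cs → tally (Os ++ Ps) cs ≡ tally Os cs ℕ.+ tally Ps cs
tally-++ []       Ps cs = ≡.refl
tally-++ (O ∷ Os) Ps cs with value O cs
... | true  = ≡.cong suc (tally-++ Os Ps cs)
... | false = tally-++ Os Ps cs

bichromatic monochromatic : ∀ {n} → Fin n × Fin n → Observable n
bichromatic   (i , j) = differ on (i ∷ j ∷ [])
monochromatic (i , j) = same on (i ∷ j ∷ [])

-- The fifteen points and the finite check.

module Configuration where

  -- The search colours the last entry first, so the order affects how early clashes are found. The
  -- unnamed entry with index 6, ω⁻¹u + ω²v, lies on no counted pair and contributes only
  -- unit-distance constraints.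
  configuration : Vec Coordinates 15
  configuration =
      (+ 2 , + 0 , + 0 , + 0)
    ∷ (+ 0 , + 1 , -[1+ 0 ] , + 1)
    ∷ (+ 2 , -[1+ 0 ] , + 0 , + 0)
    ∷ (+ 1 , + 1 , + 0 , + 0)
    ∷ (+ 1 , + 0 , + 0 , -[1+ 0 ])
    ∷ (+ 0 , + 1 , + 0 , + 0)
    ∷ (+ 1 , -[1+ 0 ] , -[1+ 0 ] , + 1)
    ∷ (+ 0 , + 0 , -[1+ 0 ] , + 1)
    ∷ (+ 1 , + 0 , -[1+ 0 ] , + 0)
    ∷ (+ 1 , + 0 , -[1+ 0 ] , + 1)
    ∷ (+ 1 , -[1+ 0 ] , -[1+ 0 ] , + 0)
    ∷ (+ 0 , + 0 , -[1+ 0 ] , + 0)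
    ∷ (+ 1 , -[1+ 0 ] , + 0 , + 0)
    ∷ (+ 0 , + 0 , + 0 , + 0)
    ∷ (+ 1 , + 0 , + 0 , + 0)
    ∷ []

  q y t t′ b₂ b₃ n w a₂ x s a₁ o m : Fin 15
  q = # 0 ; y = # 1 ; t = # 2 ; t′ = # 3 ; b₂ = # 4 ; b₃ = # 5 ; n = # 7
  w = # 8 ; a₂ = # 9 ; x = # 10 ; s = # 11 ; a₁ = # 12 ; o = # 13 ; m = # 14

  sides₁ sides₂ diagonal differing : List (Fin 15 × Fin 15)
  sides₁    = (a₁ , a₂) ∷ (a₂ , s) ∷ (s , a₁) ∷ []
  sides₂    = (x , m) ∷ (m , n) ∷ (n , x) ∷ []
  diagonal  = (o , q) ∷ []
  differing = sides₁ ++ sides₂ ++ diagonal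

  dEdges : List (Fin 15 × Fin 15)
  dEdges = (a₁ , n) ∷ (a₂ , x) ∷ (m , s) ∷ (t , a₂) ∷ (t′ , b₂) ∷ (q , w) ∷ (y , s) ∷ (m , y) ∷ []

  -- The point reflection z ↦ w - z maps x, m, n to b₃, s, b₂.
  rainbow₁ rainbow₂ : Observable 15
  rainbow₁ = rainbow on (x ∷ m ∷ n ∷ [])
  rainbow₂ = rainbow on (b₃ ∷ s ∷ b₂ ∷ [])

  mono : List (Observable 15)
  mono = List.map monochromatic dEdges

  -- A single monochromatic edge of length d can increase the excess of lower by 3,
  -- several of them increase it by at most 4.
  lower upper : List (Observable 15)
  lower = rainbow₂ ∷ List.map bichromatic differing
  upper = certain ∷ certain ∷ certain ∷ rainbow₁ ∷ mono ++ mono ++ mono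

  private
    -- Not a let: the argument is then evaluated only once.
    thrice : ℕ → ℕ
    thrice k = k ℕ.+ (k ℕ.+ k)

    tally-thrice : ∀ cs → thrice (tally mono cs) ≡ tally (mono ++ mono ++ mono) cs
    tally-thrice cs = ≡.sym (≡.trans (tally-++ mono (mono ++ mono) cs)
      (≡.cong (tally mono cs ℕ.+_) (tally-++ mono mono cs)))

    add : Bool → ℕ → ℕ
    add true  = suc
    add false = λ k → k

    add-count : ∀ b bs → count (b ∷ bs) ≡ add b (count bs)
    add-count true  bs = ≡.refl
    add-count false bs = ≡.refl

    -- Lazy in both arguments, which makes the computation below considerably faster.
    leq : ℕ → ℕ → Bool
    leq zero    _       = true
    leq (suc _) zero    = false
    leq (suc j) (suc k) = leq j k

    leq-sound : ∀ j k → T (leq j k) → j ℕ.≤ k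
    leq-sound zero    _       _ = ℕ.z≤n
    leq-sound (suc j) (suc k) h = ℕ.s≤s (leq-sound j k h)

    holdsAt : Colours 15 → Bool
    holdsAt cs = leq (tally lower cs) (3 ℕ.+ add (value rainbow₁ cs) (thrice (tally mono cs)))

    computation : everyProper configuration holdsAt ≡ true
    computation = ≡.refl

  tally-lower≤tally-upper : ∀ cs → ProperOn configuration cs → tally lower cs ℕ.≤ tally upper cs
  tally-lower≤tally-upper cs proper = ≡.subst (tally lower cs ℕ.≤_)
    (≡.cong (3 ℕ.+_) (≡.trans (≡.cong (add (value rainbow₁ cs)) (tally-thrice cs))
      (≡.sym (add-count (value rainbow₁ cs) (List.map (λ O → value O cs) (mono ++ mono ++ mono))))))
    (leq-sound _ _ (everyProper-sound configuration holdsAt computation cs proper))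

-- Realisation of the coordinates in the plane.

-- E = d/4, H = √(4 - d²)/4 and K = √3 give u = (2E , 2H), v = (2E , -2H) and
-- ω = (1 + K i)/2.
module Embedding (ℝ : Reals) (E H K : Reals.Carrier ℝ) where
  open Reals ℝ
  open OrderedField ℝ
  open Plane ℝ hiding (p)
  open PlaneGeometry ℝ
  open Solver using (solve; Polynomial; _:=_; _:+_; _:*_; _:-_; :-_; con)

  open Setoid ℂ using () renaming (sym to ≈ᶜ-sym)

  private
    -- The point au + bωu + cv + dωv, where ωu = (E - KH , H + KE) and ωv = (E + KH , KE - H). The
    -- factor 1/4 in E and H absorbs the denominator of ω.
    combination : (a b c d : Carrier) → Point
    combination a b c d =
      (fromℕ 2 * (a + c) + (b + d)) * E - K * (b - d) * H ,
      (fromℕ 2 * (a - c) + (b - d)) * H + K * (b + d) * E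

    fromℤ-sub : ∀ i j → fromℤ (i ℤ.- j) ≈ fromℤ i - fromℤ j
    fromℤ-sub i j = trans (fromℤ-+ i (ℤ.- j)) (+-congˡ (fromℤ-neg j))

    combination-cong : ∀ {a a′ b b′ c c′ d d′} → a ≈ a′ → b ≈ b′ → c ≈ c′ → d ≈ d′ →
      combination a b c d ≈ᶜ combination a′ b′ c′ d′
    combination-cong a b c d =
      +-cong (*-congʳ (+-cong (*-congˡ (+-cong a c)) (+-cong b d)))
             (-‿cong (*-congʳ (*-congˡ (+-cong b (-‿cong d))))) ,
      +-cong (*-congʳ (+-cong (*-congˡ (+-cong a (-‿cong c))) (+-cong b (-‿cong d))))
             (*-congʳ (*-congˡ (+-cong b d)))

  embed : Coordinates → Point
  embed (a , b , c , d) = combination (fromℤ a) (fromℤ b) (fromℤ c) (fromℤ d)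

  embed-⊖ : ∀ z w → embed (z ⊖ᶻ w) ≈ᶜ embed z ⊖ embed w
  embed-⊖ (a , b , c , d) (a′ , b′ , c′ , d′) = proj₁ hom , proj₂ hom
    where
    hom′ : combination (fromℤ a - fromℤ a′) (fromℤ b - fromℤ b′) (fromℤ c - fromℤ c′) (fromℤ d - fromℤ d′)
      ≈ᶜ embed (a , b , c , d) ⊖ embed (a′ , b′ , c′ , d′)
    hom′ =
      solve 11 (λ a b c d a′ b′ c′ d′ E H K →
        (con (+ 2) :* ((a :- a′) :+ (c :- c′)) :+ ((b :- b′) :+ (d :- d′))) :* E
          :- K :* ((b :- b′) :- (d :- d′)) :* H :=
        ((con (+ 2) :* (a :+ c) :+ (b :+ d)) :* E :- K :* (b :- d) :* H)
          :- ((con (+ 2) :* (a′ :+ c′) :+ (b′ :+ d′)) :* E :- K :* (b′ :- d′) :* H))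
        refl (fromℤ a) (fromℤ b) (fromℤ c) (fromℤ d) (fromℤ a′) (fromℤ b′) (fromℤ c′) (fromℤ d′) E H K ,
      solve 11 (λ a b c d a′ b′ c′ d′ E H K →
        (con (+ 2) :* ((a :- a′) :- (c :- c′)) :+ ((b :- b′) :- (d :- d′))) :* H
          :+ K :* ((b :- b′) :+ (d :- d′)) :* E :=
        ((con (+ 2) :* (a :- c) :+ (b :- d)) :* H :+ K :* (b :+ d) :* E)
          :- ((con (+ 2) :* (a′ :- c′) :+ (b′ :- d′)) :* H :+ K :* (b′ :+ d′) :* E))
        refl (fromℤ a) (fromℤ b) (fromℤ c) (fromℤ d) (fromℤ a′) (fromℤ b′) (fromℤ c′) (fromℤ d′) E H K
    conv = combination-cong (fromℤ-sub a a′) (fromℤ-sub b b′) (fromℤ-sub c c′) (fromℤ-sub d d′)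
    hom : embed ((a , b , c , d) ⊖ᶻ (a′ , b′ , c′ , d′)) ≈ᶜ embed (a , b , c , d) ⊖ embed (a′ , b′ , c′ , d′)
    hom = trans (proj₁ conv) (proj₁ hom′) , trans (proj₂ conv) (proj₂ hom′)

  reflect-embed : ∀ w z → embed (w ⊖ᶻ z) ≈ᶜ Isometry.to (pointReflection (embed w)) (embed z)
  reflect-embed w z =
    trans (proj₁ (embed-⊖ w z)) (solve 3 (λ s x y →
      s :- x := :- con (+ 1) :* x :- con (+ 0) :* y :+ s) refl _ _ (proj₂ (embed z))) ,
    trans (proj₂ (embed-⊖ w z)) (solve 3 (λ s x y →
      s :- y := :- con (+ 1) :* y :+ con (+ 0) :* x :+ s) refl _ (proj₁ (embed z)) _)

  private
    -- This is |2E(x + yω) + 2iH(p + qω)|² after K² has been replaced by 3; x² + xy + y² is the norm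
    -- form of ℤ[ω].
    quadratic : (a b c d : Carrier) → Carrier
    quadratic a b c d =
      fromℕ 4 * ((x * x + x * y + y * y) * (E * E) + (p * p + p * q + q * q) * (H * H)
                 + K * (p * y - x * q) * (E * H))
      where x = a + c ; y = b + d ; p = a - c ; q = b - d

    :quadratic : ∀ {n} (a b c d E H K : Polynomial n) → Polynomial n
    :quadratic a b c d E H K =
      con (+ 4) :* ((x :* x :+ x :* y :+ y :* y) :* (E :* E) :+ (p :* p :+ p :* q :+ q :* q) :* (H :* H)
                    :+ K :* (p :* y :- x :* q) :* (E :* H))
      where x = a :+ c ; y = b :+ d ; p = a :- c ; q = b :- d

    quadratic-cong : ∀ {a a′ b b′ c c′ d d′} → a ≈ a′ → b ≈ b′ → c ≈ c′ → d ≈ d′ →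
      quadratic a b c d ≈ quadratic a′ b′ c′ d′
    quadratic-cong a b c d = *-congˡ (+-cong (+-cong (*-congʳ (form x y)) (*-congʳ (form p q)))
      (*-congʳ (*-congˡ (+-cong (*-cong p y) (-‿cong (*-cong x q))))))
      where
      x = +-cong a c ; y = +-cong b d ; p = +-cong a (-‿cong c) ; q = +-cong b (-‿cong d)
      form : ∀ {x x′ y y′} → x ≈ x′ → y ≈ y′ → x * x + x * y + y * y ≈ x′ * x′ + x′ * y′ + y′ * y′
      form x y = +-cong (+-cong (*-cong x x) (*-cong x y)) (*-cong y y)

  module _ (K² : K * K ≈ fromℕ 3) where

    private
      norm : Coordinates → Carrier
      norm (a , b , c , d) = quadratic (fromℤ a) (fromℤ b) (fromℤ c) (fromℤ d)

      normSq-embed : ∀ z → normSq (embed z) ≈ norm z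
      normSq-embed (a , b , c , d) = trans
        (solve 7 (λ a b c d E H K →
          let x = a :+ c ; y = b :+ d ; p = a :- c ; q = b :- d
              X = (con (+ 2) :* x :+ y) :* E :- K :* q :* H
              Y = (con (+ 2) :* p :+ q) :* H :+ K :* y :* E
          in X :* X :+ Y :* Y := :quadratic a b c d E H K
             :+ (K :* K :- con (+ 3)) :* (q :* q :* (H :* H) :+ y :* y :* (E :* E)))
          refl (fromℤ a) (fromℤ b) (fromℤ c) (fromℤ d) E H K)
        (trans (+-congˡ (trans (*-congʳ (trans (+-congʳ K²) (-‿inverseʳ _))) (zeroˡ _))) (+-identityʳ _))

      -- With K² eliminated, invariance under multiplication by ω is a polynomial identity.
      norm-turn : ∀ z → norm (turn z) ≈ norm z
      norm-turn (a , b , c , d) = trans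
        (quadratic-cong (fromℤ-neg b) (fromℤ-+ a b) (fromℤ-neg d) (fromℤ-+ c d))
        (solve 7 (λ a b c d E H K →
          :quadratic (:- b) (a :+ b) (:- d) (c :+ d) E H K := :quadratic a b c d E H K)
          refl (fromℤ a) (fromℤ b) (fromℤ c) (fromℤ d) E H K)

      norm-turns : ∀ n g {z} → z ∈ turns n g → norm z ≈ norm g
      norm-turns (suc n) g (here ≡.refl) = refl
      norm-turns (suc n) g (there z∈)    = trans (norm-turns n (turn g) z∈) (norm-turn g)

    normSq-difference : ∀ g {z w} → z ⊖ᶻ w ∈ orbit g → normSq (embed z ⊖ embed w) ≈ normSq (embed g)
    normSq-difference g {z} {w} z-w∈ = trans (normSq-cong (≈ᶜ-sym (embed-⊖ z w)))
      (trans (normSq-embed (z ⊖ᶻ w)) (trans (norm-turns 6 g z-w∈) (sym (normSq-embed g))))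

    normSq-u : normSq (embed u) ≈ fromℕ 4 * (E * E + H * H)
    normSq-u = trans (normSq-embed u) (solve 3 (λ E H K →
      :quadratic (con (+ 1)) (con (+ 0)) (con (+ 0)) (con (+ 0)) E H K :=
      con (+ 4) :* (E :* E :+ H :* H)) refl E H K)

    normSq-v : normSq (embed v) ≈ fromℕ 4 * (E * E + H * H)
    normSq-v = trans (normSq-embed v) (solve 3 (λ E H K →
      :quadratic (con (+ 0)) (con (+ 0)) (con (+ 1)) (con (+ 0)) E H K :=
      con (+ 4) :* (E :* E :+ H :* H)) refl E H K)

    normSq-u+u : normSq (embed u+u) ≈ fromℕ 16 * (E * E + H * H)
    normSq-u+u = trans (normSq-embed u+u) (solve 3 (λ E H K →
      :quadratic (con (+ 2)) (con (+ 0)) (con (+ 0)) (con (+ 0)) E H K :=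
      con (+ 16) :* (E :* E :+ H :* H)) refl E H K)

    normSq-u+v : normSq (embed u+v) ≈ fromℕ 4 * E * (fromℕ 4 * E)
    normSq-u+v = trans (normSq-embed u+v) (solve 3 (λ E H K →
      :quadratic (con (+ 1)) (con (+ 0)) (con (+ 1)) (con (+ 0)) E H K :=
      con (+ 4) :* E :* (con (+ 4) :* E)) refl E H K)

    normSq-u+ωv : normSq (embed u+ωv) ≈ fromℕ 4 * ((K * E + H) * (K * E + H))
    normSq-u+ωv = trans (normSq-embed u+ωv) (trans (solve 3 (λ E H K →
      :quadratic (con (+ 1)) (con (+ 0)) (con (+ 0)) (con (+ 1)) E H K :=
      con (+ 4) :* (con (+ 3) :* (E :* E) :+ con (+ 2) :* K :* E :* H :+ H :* H)) refl E H K)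
      (*-congˡ (trans (+-congʳ (+-congʳ (*-congʳ (sym K²))))
        (solve 3 (λ E H K → K :* K :* (E :* E) :+ con (+ 2) :* K :* E :* H :+ H :* H :=
          (K :* E :+ H) :* (K :* E :+ H)) refl E H K))))

    normSq-u+ω⁻¹v : normSq (embed u+ω⁻¹v) ≈ fromℕ 4 * ((K * E - H) * (K * E - H))
    normSq-u+ω⁻¹v = trans (normSq-embed u+ω⁻¹v) (trans (solve 3 (λ E H K →
      :quadratic (con (+ 1)) (con (+ 0)) (con (+ 1)) (con -[1+ 0 ]) E H K :=
      con (+ 4) :* (con (+ 3) :* (E :* E) :- con (+ 2) :* K :* E :* H :+ H :* H)) refl E H K)
      (*-congˡ (trans (+-congʳ (+-congʳ (*-congʳ (sym K²))))
        (solve 3 (λ E H K → K :* K :* (E :* E) :- con (+ 2) :* K :* E :* H :+ H :* H :=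
          (K :* E :- H) :* (K :* E :- H)) refl E H K))))

-- Averaging the finite inequality over the group.

module Bound
  (ℝ : Reals) (c₀ : Plane.Colouring ℝ) (proper : Plane.Proper ℝ c₀)
  (μ : Plane.LeftInvariantProbability ℝ (Plane.S₄×E₂ ℝ))
  (E H K : Reals.Carrier ℝ) where

  open Reals ℝ
  open OrderedField ℝ
  open Plane ℝ hiding (p)
  open PlaneGeometry ℝ
  open ColourEvents ℝ c₀ μ
  open Embedding ℝ E H K
  open Configuration
  open Solver using (solve; _:=_; _:+_; _:*_; _:-_; :-_; con)

  module _ (K² : K * K ≈ fromℕ 3)
           (0≤E : 0# ≤ E) (0≤H : 0# ≤ H) (0≤K : 0# ≤ K)
           (E²+H² : fromℕ 4 * (E * E + H * H) ≈ fromℕ 1)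
           (far : fromℕ 1 ≤ fromℕ 16 * ((K * E - H) * (K * E - H)))
           where

    positions : ∀ {n} → Vec Coordinates n → Vec Point n
    positions = Vec.map embed

    colour-proper-at : ∀ g {n} z (zs : Vec Coordinates n) →
      ProperAt z zs (colour g (embed z)) (Vec.map (colour g) (positions zs))
    colour-proper-at g z []       = tt
    colour-proper-at g z (w ∷ ws) =
      (λ z-w∈ → colour-proper proper g {embed w} {embed z}
        ([ (λ ∈u → trans (normSq-difference K² u {z} {w} ∈u) (trans (normSq-u K²) E²+H²))
         , (λ ∈v → trans (normSq-difference K² v {z} {w} ∈v) (trans (normSq-v K²) E²+H²))
         ]′ (∈-++⁻ (orbit u) z-w∈))) ,
      colour-proper-at g z ws

    colour-proper-on : ∀ g {n} (zs : Vec Coordinates n) → ProperOn zs (Vec.map (colour g) (positions zs))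
    colour-proper-on g []       = tt
    colour-proper-on g (z ∷ zs) = colour-proper-at g z zs , colour-proper-on g zs

    event : Observable 15 → Event
    event O = colourEvent (test O) (Vec.map (embed ∘ lookup configuration) (points O))

    countAt-event : ∀ g Os →
      countAt (List.map event Os) g ≡ tally Os (Vec.map (colour g) (positions configuration))
    countAt-event g []       = ≡.refl
    countAt-event g (O ∷ Os) = count-cong
      (≡.cong (test O) (≡.trans (≡.sym (Vec.map-∘ (colour g) (embed ∘ lookup configuration) (points O)))
        (Vec.map-cong (λ i → ≡.sym (≡.trans (Vec.lookup-map i (colour g) (positions configuration))
          (≡.cong (colour g) (Vec.lookup-map i embed configuration)))) (points O))))
      (countAt-event g Os)
      where
      count-cong : ∀ {a b as bs} → a ≡ b → count as ≡ count bs → count (a ∷ as) ≡ count (b ∷ bs)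
      count-cong {true}  ≡.refl eq = ≡.cong suc eq
      count-cong {false} ≡.refl eq = eq

    expectation-lower≤upper : expectation (List.map event lower) ≤ expectation (List.map event upper)
    expectation-lower≤upper = expectation-mono (List.map event lower) (List.map event upper) (λ g →
      ≡.subst₂ ℕ._≤_ (≡.sym (countAt-event g lower)) (≡.sym (countAt-event g upper))
        (tally-lower≤tally-upper _ (colour-proper-on g configuration)))

    at : Fin 15 → Coordinates
    at = lookup configuration

    rainbow-invariant : prob (event rainbow₂) ≈ prob (event rainbow₁)
    rainbow-invariant = trans
      (colourEvent-cong rainbow
        -- The differences of z with `at x`, `at m` and `at n` evaluate to `at b₃`, `at s` and
        -- `at b₂`.
        (reflect-embed z (at x) ∷ reflect-embed z (at m) ∷ reflect-embed z (at n) ∷ []))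
      (colourEvent-invariant rainbow (embed (at x) ∷ embed (at m) ∷ embed (at n) ∷ [])
        (pointReflection (embed z)))
      where z = lookup configuration w

    Joined : Coordinates → Fin 15 × Fin 15 → Set
    Joined g (i , j) = at j ⊖ᶻ at i ∈ orbit g

    joined? : ∀ g e → Dec (Joined g e)
    joined? g (i , j) = (at j ⊖ᶻ at i) ∈? orbit g

    differs-half : ∀ g → fromℕ 1 ≤ fromℕ 4 * normSq (embed g) → ∀ {e} → Joined g e →
      fromℕ 1 ≤ fromℕ 2 * prob (event (bichromatic e))
    differs-half g far {i , j} ∈g = bichromatic-half proper (embed (at i)) (embed (at j))
      (far ⟨≤⟩ ≈⇒≤ (*-congˡ (sym (normSq-difference K² g {at j} {at i} ∈g))))

    -- As (KE + H)² = (KE - H)² + 4KEH, the first triangle is at least as large as the second, so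
    -- `far` covers both.
    far-u+ωv : fromℕ 1 ≤ fromℕ 4 * normSq (embed u+ωv)
    far-u+ωv = far ⟨≤⟩
      ≈⇒≤ (sym (+-identityʳ _)) ⟨≤⟩
      +-monoʳ-≤ _ (*-nonNeg (fromℕ-nonNeg 64) (*-nonNeg (*-nonNeg 0≤K 0≤E) 0≤H)) ⟨≤⟩
      ≈⇒≤ (trans (solve 3 (λ E H K →
        con (+ 16) :* ((K :* E :- H) :* (K :* E :- H)) :+ con (+ 64) :* (K :* E :* H) :=
        con (+ 4) :* (con (+ 4) :* ((K :* E :+ H) :* (K :* E :+ H)))) refl E H K)
        (*-congˡ (sym (normSq-u+ωv K²))))

    far-u+ω⁻¹v : fromℕ 1 ≤ fromℕ 4 * normSq (embed u+ω⁻¹v)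
    far-u+ω⁻¹v = far ⟨≤⟩ ≈⇒≤ (trans
      (solve 1 (λ z → con (+ 16) :* z := con (+ 4) :* (con (+ 4) :* z)) refl _)
      (*-congˡ (sym (normSq-u+ω⁻¹v K²))))

    far-u+u : fromℕ 1 ≤ fromℕ 4 * normSq (embed u+u)
    far-u+u = fromℕ-mono-≤ {1} {16} (ℕ.s≤s ℕ.z≤n) ⟨≤⟩ ≈⇒≤ (sym (trans (*-congˡ (normSq-u+u K²))
      (trans (solve 1 (λ z → con (+ 4) :* (con (+ 16) :* z) := con (+ 16) :* (con (+ 4) :* z)) refl _)
        (trans (*-congˡ E²+H²) (solve 0 (con (+ 16) :* con (+ 1) := con (+ 16)) refl)))))

    differing-half : All (λ e → fromℕ 1 ≤ fromℕ 2 * prob (event (bichromatic e))) differing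
    differing-half =
      All.++⁺ (halves u+ωv far-u+ωv sides₁ (toWitness {a? = All.all? (joined? u+ωv) sides₁} tt))
      (All.++⁺ (halves u+ω⁻¹v far-u+ω⁻¹v sides₂ (toWitness {a? = All.all? (joined? u+ω⁻¹v) sides₂} tt))
        (halves u+u far-u+u diagonal (toWitness {a? = All.all? (joined? u+u) diagonal} tt)))
      where
      halves : ∀ g → fromℕ 1 ≤ fromℕ 4 * normSq (embed g) → ∀ es → All (Joined g) es →
        All (λ e → fromℕ 1 ≤ fromℕ 2 * prob (event (bichromatic e))) es
      halves g far []       []         = []
      halves g far (e ∷ es) (∈g ∷ ∈gs) = differs-half g far {e} ∈g ∷ halves g far es ∈gs

    all-dEdges : All (Joined u+v) dEdges
    all-dEdges = toWitness {a? = All.all? (joined? u+v) dEdges} tt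

    private
      module _ (P : Carrier) where

        expectation-constant : ∀ Os → All (λ O → prob (event O) ≈ P) Os →
          expectation (List.map event Os) ≈ fromℕ (length Os) * P
        expectation-constant []       []         = sym (zeroˡ P)
        expectation-constant (O ∷ Os) (eq ∷ eqs) = trans (+-cong eq (expectation-constant Os eqs))
          (trans (+-congʳ (sym (*-identityˡ P))) (sym (distribʳ P 1# _)))

      expectation-half : ∀ es → All (λ e → fromℕ 1 ≤ fromℕ 2 * prob (event (bichromatic e))) es →
        fromℕ (length es) ≤ fromℕ 2 * expectation (List.map event (List.map bichromatic es))
      expectation-half []       []         = ≈⇒≤ (sym (zeroʳ _))
      expectation-half (e ∷ es) (le ∷ les) =
        +-mono-≤ (≈⇒≤ (sym fromℕ-1) ⟨≤⟩ le) (expectation-half es les) ⟨≤⟩ ≈⇒≤ (sym (distribˡ _ _ _))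

      certain≈1 : prob (event certain) ≈ fromℕ 1
      certain≈1 = trans (prob-cong (event certain) always (λ _ → ≡.refl)) (trans prob-always (sym fromℕ-1))

      -- Here D is the expected number of bichromatic pairs, α and β are the probabilities of
      -- `rainbow₂` and `rainbow₁`, ι is that of `certain`, and M is the sum of the 24 monochromatic
      -- terms.
      conclude : ∀ {D M α β ι P} → α + D ≤ ι + (ι + (ι + (β + M))) →
        fromℕ 7 ≤ fromℕ 2 * D → α ≈ β → ι ≈ fromℕ 1 → M ≈ fromℕ 24 * P → fromℕ 1 ≤ fromℕ 48 * P
      conclude {D} {M} {α} {β} {ι} {P} le half α≈β ι≈1 M≈24P = +-cancelʳ-≤ (fromℕ 6)
        (≈⇒≤ (solve 0 (con (+ 1) :+ con (+ 6) := con (+ 7)) refl) ⟨≤⟩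
        half ⟨≤⟩
        +-cancelʳ-≤ (fromℕ 2 * β) (
          ≈⇒≤ (trans (solve 2 (λ D β → con (+ 2) :* D :+ con (+ 2) :* β := con (+ 2) :* (β :+ D)) refl D β)
            (*-congˡ (+-congʳ (sym α≈β)))) ⟨≤⟩
          *-monoʳ-≤ (fromℕ-nonNeg 2) le ⟨≤⟩
          ≈⇒≤ (trans (*-congˡ (+-cong ι≈1 (+-cong ι≈1 (+-cong ι≈1 (+-congˡ M≈24P)))))
            (solve 2 (λ β P →
              con (+ 2) :* (con (+ 1) :+ (con (+ 1) :+ (con (+ 1) :+ (β :+ con (+ 24) :* P)))) :=
              con (+ 48) :* P :+ con (+ 6) :+ con (+ 2) :* β) refl β P))))

    bound : ∀ X Y → normSq (Y ⊖ X) ≈ fromℕ 4 * E * (fromℕ 4 * E) →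
      fromℕ 1 ≤ fromℕ 48 * Plane.p ℝ c₀ μ X Y
    bound X Y XY = conclude expectation-lower≤upper (expectation-half differing differing-half)
      rainbow-invariant certain≈1
      (expectation-constant P (mono ++ mono ++ mono) (All.++⁺ monos (All.++⁺ monos monos)))
      where
      P = Plane.p ℝ c₀ μ X Y
      mono≈P : ∀ e → Joined u+v e → prob (event (monochromatic e)) ≈ P
      mono≈P (i , j) ∈u+v = trans
        (congruent-prob same {embed (at i)} {embed (at j)} {X} {Y}
          (trans (normSq-difference K² u+v {at j} {at i} ∈u+v) (trans (normSq-u+v K²) (sym XY))))
        (sym (p≈prob X Y))
      all-mono≈P : ∀ es → All (Joined u+v) es → All (λ O → prob (event O) ≈ P) (List.map monochromatic es)
      all-mono≈P []       []         = []
      all-mono≈P (e ∷ es) (∈u+v ∷ ∈s) = mono≈P e ∈u+v ∷ all-mono≈P es ∈s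
      monos : All (λ O → prob (event O) ≈ P) mono
      monos = all-mono≈P dEdges all-dEdges

-- From the thresholds for d to the lower bound on |u + ω⁻¹v|.

module Thresholds (ℝ : Reals) where
  open Reals ℝ
  open OrderedField ℝ
  open Solver using (solve; _:=_; _:+_; _:*_; _:-_; con)

  fromℕ-* : ∀ j k → fromℕ (j ℕ.* k) ≈ fromℕ j * fromℕ k
  fromℕ-* = SemiringMult.×1-homo-* semiring

  √3 √15 : Carrier
  √3  = √ fromℕ 3
  √15 = √ fromℕ 15

  √3² : √3 * √3 ≈ fromℕ 3
  √3² = √-square (fromℕ-nonNeg 3)

  √15² : √15 * √15 ≈ fromℕ 15
  √15² = √-square (fromℕ-nonNeg 15)

  module _ {x} (a b s m : ℕ) (0≤x : 0# ≤ x) (x² : fromℕ (suc b) * (x * x) ≈ fromℕ a) where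
    private
      lhs≈ : fromℕ (suc b) * (fromℕ s * x * (fromℕ s * x)) ≈ fromℕ (a ℕ.* (s ℕ.* s))
      lhs≈ = trans (solve 3 (λ b s x → b :* (s :* x :* (s :* x)) := b :* (x :* x) :* (s :* s)) refl _ _ _)
        (trans (*-cong x² (sym (fromℕ-* s s))) (sym (fromℕ-* a (s ℕ.* s))))
      rhs≈ : fromℕ (suc b) * (fromℕ m * fromℕ m) ≈ fromℕ (suc b ℕ.* (m ℕ.* m))
      rhs≈ = trans (*-congˡ (sym (fromℕ-* m m))) (sym (fromℕ-* (suc b) (m ℕ.* m)))

    -- With x² = a/(b + 1), squaring turns a rational bound x ≤ m/s into a comparison of natural
    -- numbers. The parameter b is the denominator minus one, so the arguments 14 14 stand for 14/15
    -- and 1 4 for 1/5.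
    root≤ : True (a ℕ.* (s ℕ.* s) ℕ.≤? suc b ℕ.* (m ℕ.* m)) → fromℕ s * x ≤ fromℕ m
    root≤ le = square-cancel-≤ (fromℕ-nonNeg m) (*-cancelˡ-≤ (fromℕ-suc≉0 b) (fromℕ-nonNeg (suc b))
      (≈⇒≤ lhs≈ ⟨≤⟩ fromℕ-mono-≤ (toWitness le) ⟨≤⟩ ≈⇒≤ (sym rhs≈)))

    root≥ : True (suc b ℕ.* (m ℕ.* m) ℕ.≤? a ℕ.* (s ℕ.* s)) → fromℕ m ≤ fromℕ s * x
    root≥ le = square-cancel-≤ (*-nonNeg (fromℕ-nonNeg s) 0≤x)
      (*-cancelˡ-≤ (fromℕ-suc≉0 b) (fromℕ-nonNeg (suc b))
      (≈⇒≤ rhs≈ ⟨≤⟩ fromℕ-mono-≤ (toWitness le) ⟨≤⟩ ≈⇒≤ (sym lhs≈)))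

  one* : ∀ x → fromℕ 1 * x ≈ x
  one* x = trans (*-congʳ fromℕ-1) (*-identityˡ x)

  √ℕ-square : ∀ n → fromℕ 1 * (√ fromℕ n * √ fromℕ n) ≈ fromℕ n
  √ℕ-square n = trans (one* _) (√-square (fromℕ-nonNeg n))

  √ℕ≤ : ∀ n s m → True (n ℕ.* (s ℕ.* s) ℕ.≤? 1 ℕ.* (m ℕ.* m)) → fromℕ s * √ fromℕ n ≤ fromℕ m
  √ℕ≤ n s m = root≤ n 0 s m (√-nonNeg _) (√ℕ-square n)

  √ℕ≥ : ∀ n s m → True (1 ℕ.* (m ℕ.* m) ℕ.≤? n ℕ.* (s ℕ.* s)) → fromℕ m ≤ fromℕ s * √ fromℕ n
  √ℕ≥ n s m = root≥ n 0 s m (√-nonNeg _) (√ℕ-square n)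

  α β : Carrier
  α = √ (fromℕ 14 / fromℕ 15)
  β = fromℕ 1 / √ fromℕ 5

  α² : fromℕ 15 * (α * α) ≈ fromℕ 14
  α² = trans (*-congˡ (√-square (*-nonNeg (fromℕ-nonNeg 14) (⁻¹-nonNeg (fromℕ-suc≉0 14) (fromℕ-nonNeg 15)))))
    (/-inverse (fromℕ-suc≉0 14))

  √5≉0 : ¬ √ fromℕ 5 ≈ 0#
  √5≉0 eq = fromℕ-suc≉0 4 (trans (sym (√-square (fromℕ-nonNeg 5))) (trans (*-congʳ eq) (zeroˡ _)))

  0≤β : 0# ≤ β
  0≤β = *-nonNeg (fromℕ-nonNeg 1) (⁻¹-nonNeg √5≉0 (√-nonNeg _))

  β² : fromℕ 5 * (β * β) ≈ fromℕ 1
  β² = trans (*-congʳ (sym (√-square (fromℕ-nonNeg 5))))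
    (trans (solve 2 (λ r b → r :* r :* (b :* b) := r :* b :* (r :* b)) refl (√ fromℕ 5) β)
      (trans (*-cong (/-inverse √5≉0) (/-inverse √5≉0)) (one* _)))

  -- The conditions d ≤ (√15 - √3)/4 and d ≥ (√15 + √3)/4 cleared of denominators, the weakest of
  -- the three hypotheses on either side.
  Short Long : Carrier → Set
  Short d = fromℕ 4 * d + √3 ≤ √15
  Long d  = √15 + √3 ≤ fromℕ 4 * d

  private
    clear : ∀ n {x y} → fromℕ (suc n) * x ≤ fromℕ (suc n) * y → x ≤ y
    clear n = *-cancelˡ-≤ (fromℕ-suc≉0 n) (fromℕ-nonNeg (suc n))

    twice : ∀ {x y} → x ≤ y → fromℕ 2 * x ≤ fromℕ 2 * y
    twice = *-monoʳ-≤ (fromℕ-nonNeg 2)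

    four : ∀ {x y} → x ≤ y → fromℕ 4 * x ≤ fromℕ 4 * y
    four = *-monoʳ-≤ (fromℕ-nonNeg 4)

  -- The scales 20, 30 and 56 are fine enough for the rounded roots to satisfy the inequalities.
  short₁ : ∀ {d} → d ≤ (√ fromℕ 6 - √ fromℕ 2) / fromℕ 2 → Short d
  short₁ {d} d≤ = clear 19 (+-cancelʳ-≤ (fromℕ 2 * (fromℕ 20 * r₂))
    (≈⇒≤ (solve 3 (λ d k r →
       con (+ 20) :* (con (+ 4) :* d :+ k) :+ con (+ 2) :* (con (+ 20) :* r) :=
       con (+ 40) :* (con (+ 2) :* d) :+ (con (+ 20) :* k :+ con (+ 2) :* (con (+ 20) :* r))) refl d √3 r₂) ⟨≤⟩
     +-mono-≤ (*-monoʳ-≤ (fromℕ-nonNeg 40) (twice d≤ ⟨≤⟩ ≈⇒≤ (/-inverse (fromℕ-suc≉0 1)))) ≤-refl ⟨≤⟩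
     ≈⇒≤ (solve 3 (λ r₆ k r →
       con (+ 40) :* (r₆ :- r) :+ (con (+ 20) :* k :+ con (+ 2) :* (con (+ 20) :* r)) :=
       con (+ 2) :* (con (+ 20) :* r₆) :+ con (+ 20) :* k) refl (√ fromℕ 6) √3 r₂) ⟨≤⟩
     +-mono-≤ (twice (√ℕ≤ 6 20 49 tt)) (√ℕ≤ 3 20 35 tt) ⟨≤⟩
     ≈⇒≤ (solve 0 (con (+ 2) :* con (+ 49) :+ con (+ 35) := con (+ 77) :+ con (+ 2) :* con (+ 28)) refl) ⟨≤⟩
     +-mono-≤ (√ℕ≥ 15 20 77 tt) (twice (√ℕ≥ 2 20 28 tt))))
    where r₂ = √ fromℕ 2

  short₂ : ∀ {d} → d ≤ α - β → Short d
  short₂ {d} d≤ = clear 29 (+-cancelʳ-≤ (fromℕ 4 * (fromℕ 30 * β))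
    (≈⇒≤ (solve 3 (λ d k b →
       con (+ 30) :* (con (+ 4) :* d :+ k) :+ con (+ 4) :* (con (+ 30) :* b) :=
       con (+ 120) :* d :+ (con (+ 30) :* k :+ con (+ 4) :* (con (+ 30) :* b))) refl d √3 β) ⟨≤⟩
     +-mono-≤ (*-monoʳ-≤ (fromℕ-nonNeg 120) d≤) ≤-refl ⟨≤⟩
     ≈⇒≤ (solve 3 (λ a k b →
       con (+ 120) :* (a :- b) :+ (con (+ 30) :* k :+ con (+ 4) :* (con (+ 30) :* b)) :=
       con (+ 4) :* (con (+ 30) :* a) :+ con (+ 30) :* k) refl α √3 β) ⟨≤⟩
     -- The roundings at scale 30 leave no slack: both sides become 168.
     +-mono-≤ (four (root≤ 14 14 30 29 (√-nonNeg _) α² tt)) (√ℕ≤ 3 30 52 tt) ⟨≤⟩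
     ≈⇒≤ (solve 0 (con (+ 4) :* con (+ 29) :+ con (+ 52) := con (+ 116) :+ con (+ 4) :* con (+ 13)) refl) ⟨≤⟩
     +-mono-≤ (√ℕ≥ 15 30 116 tt) (four (root≥ 1 4 30 13 0≤β β² tt))))

  short₃ : ∀ {d} → d ≤ √15 / fromℕ 4 - √3 / fromℕ 4 → Short d
  short₃ d≤ = +-mono-≤ (four d≤) ≤-refl ⟨≤⟩
    ≈⇒≤ (trans (solve 3 (λ f k i →
             con (+ 4) :* (f :* i :- k :* i) :+ k := f :* (con (+ 4) :* i) :- k :* (con (+ 4) :* i) :+ k)
           refl √15 √3 (fromℕ 4 ⁻¹))
      (trans (+-congʳ (+-cong (*-congˡ 4i) (-‿cong (*-congˡ 4i))))
        (solve 2 (λ f k → f :* con (+ 1) :- k :* con (+ 1) :+ k := f) refl √15 √3)))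
    where
    4i : fromℕ 4 * fromℕ 4 ⁻¹ ≈ fromℕ 1
    4i = trans (⁻¹-inverseʳ _ (fromℕ-suc≉0 3)) (sym fromℕ-1)

  long₄ : ∀ {d} → (√15 + √3) / fromℕ 4 ≤ d → Long d
  long₄ ≤d = ≈⇒≤ (sym (/-inverse (fromℕ-suc≉0 3))) ⟨≤⟩ four ≤d

  -- At the same scale 4(α + β) and 4√2 are both at least 316, so one estimate serves `long₅` and
  -- `long₆`.
  56[√15+√3]≤314 : fromℕ 56 * (√15 + √3) ≤ fromℕ 314
  56[√15+√3]≤314 = ≈⇒≤ (distribˡ _ _ _) ⟨≤⟩ +-mono-≤ (√ℕ≤ 15 56 217 tt) (√ℕ≤ 3 56 97 tt) ⟨≤⟩
    ≈⇒≤ (solve 0 (con (+ 217) :+ con (+ 97) := con (+ 314)) refl)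

  long₅ : ∀ {d} → α + β ≤ d → Long d
  long₅ {d} ≤d = clear 55 (56[√15+√3]≤314 ⟨≤⟩
    fromℕ-mono-≤ {314} {316} (toWitness {a? = 314 ℕ.≤? 316} tt) ⟨≤⟩
    ≈⇒≤ (solve 0 (con (+ 316) := con (+ 4) :* (con (+ 54) :+ con (+ 25))) refl) ⟨≤⟩
    four (+-mono-≤ (root≥ 14 14 56 54 (√-nonNeg _) α² tt) (root≥ 1 4 56 25 0≤β β² tt) ⟨≤⟩
          ≈⇒≤ (sym (distribˡ _ _ _)) ⟨≤⟩ *-monoʳ-≤ (fromℕ-nonNeg 56) ≤d) ⟨≤⟩
    ≈⇒≤ (solve 1 (λ d → con (+ 4) :* (con (+ 56) :* d) := con (+ 56) :* (con (+ 4) :* d)) refl d))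

  long₆ : ∀ {d} → √ fromℕ 2 ≤ d → Long d
  long₆ {d} ≤d = clear 55 (56[√15+√3]≤314 ⟨≤⟩
    fromℕ-mono-≤ {314} {316} (toWitness {a? = 314 ℕ.≤? 316} tt) ⟨≤⟩
    ≈⇒≤ (solve 0 (con (+ 316) := con (+ 4) :* con (+ 79)) refl) ⟨≤⟩
    four (√ℕ≥ 2 56 79 tt ⟨≤⟩ *-monoʳ-≤ (fromℕ-nonNeg 56) ≤d) ⟨≤⟩
    ≈⇒≤ (solve 1 (λ d → con (+ 4) :* (con (+ 56) :* d) := con (+ 56) :* (con (+ 4) :* d)) refl d))

  α+β≤2 : α + β ≤ fromℕ 2
  α+β≤2 = +-mono-≤ (≈⇒≤ (sym (one* α)) ⟨≤⟩ root≤ 14 14 1 1 (√-nonNeg _) α² tt)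
                   (≈⇒≤ (sym (one* β)) ⟨≤⟩ root≤ 1 4 1 1 0≤β β² tt) ⟨≤⟩
    ≈⇒≤ (solve 0 (con (+ 1) :+ con (+ 1) := con (+ 2)) refl)

  √2≤2 : √ fromℕ 2 ≤ fromℕ 2
  √2≤2 = ≈⇒≤ (sym (one* _)) ⟨≤⟩ √ℕ≤ 2 1 2 tt

  √15≤4 : √15 ≤ fromℕ 4
  √15≤4 = ≈⇒≤ (sym (one* _)) ⟨≤⟩ √ℕ≤ 15 1 4 tt

  short-≤2 : ∀ {d} → 0# ≤ d → Short d → d ≤ fromℕ 2
  short-≤2 {d} 0≤d h = clear 3 (≈⇒≤ (sym (+-identityʳ _)) ⟨≤⟩ +-monoʳ-≤ _ (√-nonNeg _) ⟨≤⟩ h ⟨≤⟩ √15≤4 ⟨≤⟩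
    fromℕ-mono-≤ {4} {8} (toWitness {a? = 4 ℕ.≤? 8} tt) ⟨≤⟩
    ≈⇒≤ (solve 0 (con (+ 8) := con (+ 4) :* con (+ 2)) refl))

  square-≥1 : ∀ {x} → fromℕ 1 ≤ x → fromℕ 1 ≤ x * x
  square-≥1 1≤x = ≈⇒≤ (sym (one* _)) ⟨≤⟩
    *-mono-≤ (fromℕ-nonNeg 1) (fromℕ-nonNeg 1 ⟨≤⟩ 1≤x) 1≤x 1≤x

  private
    module _ {d h} (0≤d : 0# ≤ d) (0≤h : 0# ≤ h) (h² : h * h ≈ fromℕ 4 - d * d) where

      rest≈ : fromℕ 4 - fromℕ 16 * (d * d) + fromℕ 4 * (√3 * √3) * (d * d) - √3 * √3 ≈
              fromℕ 1 - fromℕ 4 * (d * d)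
      rest≈ = trans (+-cong (+-congˡ (*-congʳ (*-congˡ √3²))) (-‿cong √3²))
        (solve 1 (λ d → con (+ 4) :- con (+ 16) :* (d :* d) :+ con (+ 4) :* con (+ 3) :* (d :* d) :- con (+ 3)
          := con (+ 1) :- con (+ 4) :* (d :* d)) refl d)

      15+rest≈ : fromℕ 15 + (fromℕ 1 - fromℕ 4 * (d * d)) ≈ fromℕ 4 * (h * h)
      15+rest≈ = trans (solve 1 (λ d → con (+ 15) :+ (con (+ 1) :- con (+ 4) :* (d :* d)) :=
        con (+ 4) :* (con (+ 4) :- d :* d)) refl d) (*-congˡ (sym h²))

      -- Completing the square explains √15: 4(1 + √3 d)² = (4d + √3)² + 1 - 4d² ≤ 15 + 1 - 4d² =
      -- 4h². The companion `long⇒≥` uses 4(√3 d - 1)² = (4d - √3)² + 1 - 4d².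
      short⇒≤ : Short d → fromℕ 1 + √3 * d ≤ h
      short⇒≤ le = square-cancel-≤ 0≤h (clear 3 (
        ≈⇒≤ (trans (solve 2 (λ k d →
              con (+ 4) :* ((con (+ 1) :+ k :* d) :* (con (+ 1) :+ k :* d)) :=
              (con (+ 4) :* d :+ k) :* (con (+ 4) :* d :+ k) :+
                (con (+ 4) :- con (+ 16) :* (d :* d) :+ con (+ 4) :* (k :* k) :* (d :* d) :- k :* k)) refl √3 d)
            (+-congˡ rest≈)) ⟨≤⟩
        +-mono-≤ (*-mono-≤ 0≤4d+√3 (√-nonNeg _) le le ⟨≤⟩ ≈⇒≤ √15²) ≤-refl ⟨≤⟩
        ≈⇒≤ 15+rest≈))
        where
        0≤4d+√3 : 0# ≤ fromℕ 4 * d + √3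
        0≤4d+√3 = +-nonNeg (*-nonNeg (fromℕ-nonNeg 4) 0≤d) (√-nonNeg _)

      long⇒≥ : Long d → h ≤ √3 * d - fromℕ 1
      long⇒≥ ge = square-cancel-≤ (x≤y⇒0≤y-x 1≤√3d) (clear 3 (
        ≈⇒≤ (sym 15+rest≈) ⟨≤⟩
        +-mono-≤ (≈⇒≤ (sym √15²) ⟨≤⟩ *-mono-≤ (√-nonNeg _) (√-nonNeg _ ⟨≤⟩ √15≤) √15≤ √15≤) ≤-refl ⟨≤⟩
        ≈⇒≤ (trans (+-congˡ (sym rest≈))
            (solve 2 (λ k d →
              (con (+ 4) :* d :- k) :* (con (+ 4) :* d :- k) :+
                (con (+ 4) :- con (+ 16) :* (d :* d) :+ con (+ 4) :* (k :* k) :* (d :* d) :- k :* k) :=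
              con (+ 4) :* ((k :* d :- con (+ 1)) :* (k :* d :- con (+ 1)))) refl √3 d))))
        where
        √15≤ : √15 ≤ fromℕ 4 * d - √3
        √15≤ = +-cancelʳ-≤ √3 (ge ⟨≤⟩ ≈⇒≤ (solve 2 (λ z k → z := z :- k :+ k) refl (fromℕ 4 * d) √3))
        √3≤√15 : √3 ≤ √15
        √3≤√15 = square-cancel-≤ (√-nonNeg _) (≈⇒≤ √3² ⟨≤⟩
          fromℕ-mono-≤ {3} {15} (toWitness {a? = 3 ℕ.≤? 15} tt) ⟨≤⟩ ≈⇒≤ (sym √15²))
        -- Comparing squares requires √3 d - 1 ≥ 0. From 4d ≥ √15 + √3 ≥ 2√3 follows 4√3 d ≥ 6.
        1≤√3d : fromℕ 1 ≤ √3 * d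
        1≤√3d = clear 3 (
          ≈⇒≤ (solve 0 (con (+ 4) :* con (+ 1) := con (+ 4)) refl) ⟨≤⟩
          fromℕ-mono-≤ {4} {6} (toWitness {a? = 4 ℕ.≤? 6} tt) ⟨≤⟩
          ≈⇒≤ (trans (solve 0 (con (+ 6) := con (+ 3) :+ con (+ 3)) refl)
            (trans (+-cong (sym √3²) (sym √3²)) (sym (distribˡ √3 √3 √3)))) ⟨≤⟩
          *-monoʳ-≤ (√-nonNeg _) (+-mono-≤ √3≤√15 ≤-refl ⟨≤⟩ ge) ⟨≤⟩
          ≈⇒≤ (solve 2 (λ k d → k :* (con (+ 4) :* d) := con (+ 4) :* (k :* d)) refl √3 d))

  -- |u + ω⁻¹v| = |√3 d - √(4 - d²)| / 2
  short⊎long⇒far : ∀ {d h} → 0# ≤ d → 0# ≤ h → h * h ≈ fromℕ 4 - d * d → Short d ⊎ Long d →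
    fromℕ 1 ≤ (√3 * d - h) * (√3 * d - h)
  short⊎long⇒far {d} {h} 0≤d 0≤h h² (inj₁ le) =
    square-≥1 (+-cancelʳ-≤ (√3 * d) (short⇒≤ 0≤d 0≤h h² le ⟨≤⟩
      ≈⇒≤ (solve 2 (λ h z → h := h :- z :+ z) refl h (√3 * d)))) ⟨≤⟩
    ≈⇒≤ (solve 2 (λ h z → (h :- z) :* (h :- z) := (z :- h) :* (z :- h)) refl h (√3 * d))
  short⊎long⇒far {d} {h} 0≤d 0≤h h² (inj₂ ge) =
    square-≥1 (+-cancelʳ-≤ (h - fromℕ 1)
      (≈⇒≤ (solve 1 (λ h → con (+ 1) :+ (h :- con (+ 1)) := h) refl h) ⟨≤⟩
       long⇒≥ 0≤d 0≤h h² ge ⟨≤⟩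
       ≈⇒≤ (solve 2 (λ h z → z :- con (+ 1) := z :- h :+ (h :- con (+ 1))) refl h (√3 * d))))

-- The uniform bound 1/48 and the six ranges.

module Main (ℝ : Reals) where
  open Reals ℝ
  open OrderedField ℝ
  open Plane ℝ
  open PlaneGeometry ℝ
  open Thresholds ℝ
  open Solver using (solve; _:=_; _:+_; _:*_; _:-_; con)

  monochromatic≥1/48 : (c₀ : Colouring) → Proper c₀ → (μ : LeftInvariantProbability S₄×E₂) →
    ∀ d → 0# ≤ d → d ≤ fromℕ 2 → Short d ⊎ Long d →
    ∀ A B → dist A B ≈ d → fromℕ 1 ≤ fromℕ 48 * p c₀ μ A B
  monochromatic≥1/48 c₀ proper μ d 0≤d d≤2 range A B AB =
    Bound.bound ℝ c₀ proper μ (i * d) (i * h) √3 √3² (*-nonNeg 0≤i 0≤d) (*-nonNeg 0≤i 0≤h) (√-nonNeg _)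
      unit far A B distance
    where
    i = fromℕ 4 ⁻¹
    4i : fromℕ 4 * i ≈ fromℕ 1
    4i = trans (⁻¹-inverseʳ _ (fromℕ-suc≉0 3)) (sym fromℕ-1)
    0≤i : 0# ≤ i
    0≤i = ⁻¹-nonNeg (fromℕ-suc≉0 3) (fromℕ-nonNeg 4)
    h = √ (fromℕ 4 - d * d)
    0≤h : 0# ≤ h
    0≤h = √-nonNeg _
    h² : h * h ≈ fromℕ 4 - d * d
    h² = √-square (x≤y⇒0≤y-x (*-mono-≤ 0≤d (fromℕ-nonNeg 2) d≤2 d≤2 ⟨≤⟩
      ≈⇒≤ (solve 0 (con (+ 2) :* con (+ 2) := con (+ 4)) refl)))
    4i*4i : fromℕ 4 * i * (fromℕ 4 * i) ≈ fromℕ 1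
    4i*4i = trans (*-cong 4i 4i) (one* _)
    unit : fromℕ 4 * (i * d * (i * d) + i * h * (i * h)) ≈ fromℕ 1
    unit = trans (solve 3 (λ i d h → con (+ 4) :* (i :* d :* (i :* d) :+ i :* h :* (i :* h)) :=
      con (+ 4) :* i :* i :* (d :* d :+ h :* h)) refl i d h)
      (trans (*-congˡ (+-congˡ h²))
      (trans (solve 2 (λ i d → con (+ 4) :* i :* i :* (d :* d :+ (con (+ 4) :- d :* d)) :=
        con (+ 4) :* i :* (con (+ 4) :* i)) refl i d) 4i*4i))
    far : fromℕ 1 ≤ fromℕ 16 * ((√3 * (i * d) - i * h) * (√3 * (i * d) - i * h))
    far = short⊎long⇒far 0≤d 0≤h h² range ⟨≤⟩
      ≈⇒≤ (trans (sym (one* _)) (trans (*-congʳ (sym 4i*4i))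
        (solve 4 (λ i k d h → con (+ 4) :* i :* (con (+ 4) :* i) :* ((k :* d :- h) :* (k :* d :- h)) :=
          con (+ 16) :* ((k :* (i :* d) :- i :* h) :* (k :* (i :* d) :- i :* h))) refl i √3 d h)))
    distance : normSq (B ⊖ A) ≈ fromℕ 4 * (i * d) * (fromℕ 4 * (i * d))
    distance = trans (solve 4 (λ x y u v → (u :- x) :* (u :- x) :+ (v :- y) :* (v :- y) :=
      (x :- u) :* (x :- u) :+ (y :- v) :* (y :- v)) refl (proj₁ A) (proj₂ A) (proj₁ B) (proj₂ B))
      (trans (dist⇒normSq {A} {B} AB) (sym (trans
        (solve 2 (λ i d → con (+ 4) :* (i :* d) :* (con (+ 4) :* (i :* d)) :=
          con (+ 4) :* i :* (con (+ 4) :* i) :* (d :* d)) refl i d)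
        (trans (*-congʳ 4i*4i) (one* _)))))

  -- The decidable hypothesis says a/(b + 1) ≤ 1/48; again b is the denominator minus one. The
  -- tightest instance is 48 ≤ 50, and 14/775 needs 672 ≤ 775.
  fraction-≤ : ∀ {x} a b → True (48 ℕ.* a ℕ.≤? suc b) → fromℕ 1 ≤ fromℕ 48 * x →
    fromℕ a / fromℕ (suc b) ≤ x
  fraction-≤ {x} a b le 1≤48x = *-cancelˡ-≤ (fromℕ-suc≉0 b) (fromℕ-nonNeg (suc b))
    (≈⇒≤ (/-inverse (fromℕ-suc≉0 b)) ⟨≤⟩
     *-cancelˡ-≤ (fromℕ-suc≉0 47) (fromℕ-nonNeg 48)
       (≈⇒≤ (sym (fromℕ-* 48 a)) ⟨≤⟩
        fromℕ-mono-≤ {48 ℕ.* a} {suc b} (toWitness le) ⟨≤⟩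
        ≈⇒≤ (sym (trans (*-comm _ _) (one* (fromℕ (suc b))))) ⟨≤⟩
        *-monoʳ-≤ (fromℕ-nonNeg (suc b)) 1≤48x ⟨≤⟩
        ≈⇒≤ (solve 2 (λ b x → b :* (con (+ 48) :* x) := con (+ 48) :* (b :* x)) refl (fromℕ (suc b)) x)))

mainTheorem5 :
    (ℝ : Reals) →
    let open Reals ℝ
        open Plane ℝ
    in
    (c₀ : Colouring) → Proper c₀ →
    (μ : LeftInvariantProbability S₄×E₂) →
    ∀ d → 0# ≤ d →
    ∀ A B → dist A B ≈ d →
      (d ≤ (√ fromℕ 6 - √ fromℕ 2) / fromℕ 2 →
         fromℕ 1 / fromℕ 50 ≤ p c₀ μ A B)
    × ((√ fromℕ 6 - √ fromℕ 2) / fromℕ 2 < d →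
       d ≤ √ (fromℕ 14 / fromℕ 15) - fromℕ 1 / √ fromℕ 5 →
         fromℕ 14 / fromℕ 775 ≤ p c₀ μ A B)
    × (√ (fromℕ 14 / fromℕ 15) - fromℕ 1 / √ fromℕ 5 < d →
       d ≤ √ fromℕ 15 / fromℕ 4 - √ fromℕ 3 / fromℕ 4 →
         fromℕ 1 / fromℕ 100 ≤ p c₀ μ A B)
    × ((√ fromℕ 15 + √ fromℕ 3) / fromℕ 4 ≤ d →
       d < √ (fromℕ 14 / fromℕ 15) + fromℕ 1 / √ fromℕ 5 →
         fromℕ 1 / fromℕ 100 ≤ p c₀ μ A B)
    × (√ (fromℕ 14 / fromℕ 15) + fromℕ 1 / √ fromℕ 5 ≤ d →
       d < √ fromℕ 2 →
         fromℕ 14 / fromℕ 775 ≤ p c₀ μ A B)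
    × (√ fromℕ 2 ≤ d →
       d < fromℕ 2 →
         fromℕ 1 / fromℕ 50 ≤ p c₀ μ A B)
mainTheorem5 ℝ c₀ proper μ d 0≤d A B AB =
    (λ d≤ → fraction-≤ 1 49 tt (close (short₁ d≤)))
  , (λ _ d≤ → fraction-≤ 14 774 tt (close (short₂ d≤)))
  , (λ _ d≤ → fraction-≤ 1 99 tt (close (short₃ d≤)))
  , (λ ≤d d< → fraction-≤ 1 99 tt (≥1/48 (proj₁ d< ⟨≤⟩ α+β≤2) (inj₂ (long₄ ≤d))))
  , (λ ≤d d< → fraction-≤ 14 774 tt (≥1/48 (proj₁ d< ⟨≤⟩ √2≤2) (inj₂ (long₅ ≤d))))
  , (λ ≤d d< → fraction-≤ 1 49 tt (≥1/48 (proj₁ d<) (inj₂ (long₆ ≤d))))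
  where
  open Reals ℝ
  open Plane ℝ
  open OrderedField ℝ
  open Thresholds ℝ
  open Main ℝ
  ≥1/48 : d ≤ fromℕ 2 → Short d ⊎ Long d → fromℕ 1 ≤ fromℕ 48 * p c₀ μ A B
  ≥1/48 d≤2 range = monochromatic≥1/48 c₀ proper μ d 0≤d d≤2 range A B AB
  close : Short d → fromℕ 1 ≤ fromℕ 48 * p c₀ μ A B
  close le = ≥1/48 (short-≤2 0≤d le) (inj₁ le)
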